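{- For every integer $h$ with $3\le h\le 41$ and $8\nmid h$, and for every $h\in\{44,52,60,68,76\}$, there exist infinitely many $n$ such that $h$ divides $b_2(n)$.
   Context: $b_2(n)$ denotes the number of binary partitions of $n\in\mathbb N_0$, i.e. the number of representations $n=n_0+2n_1+4n_2+\dots+2^tn_t$ with all $n_i\in\mathbb N_0$. -}

module Defs where

open import Data.Nat using (ℕ; zero; suc; _+_; _*_; _∸_; _^_; _≤_)
open import Data.Nat.Divisibility using (_∣_)
open import Data.List using (List; map; upTo; _∷_; [])
open import Data.Nat.ListAction using (sum)
open import Relation.Nullary using (yes; no)
open import Data.Nat using (_≤?_)
open import Data.Product using (∃; _×_)
open import Data.Sum using (_⊎_)

-- reps k m = number of tuples (n₀,…,n_k) ∈ ℕ^(k+1) with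
--   n₀ + 2 n₁ + 4 n₂ + … + 2^k n_k = m.
-- Recursion on the last coordinate n_k = j (j ranges over 0 … m, and only
-- those j with 2^k j ≤ m contribute).
reps : ℕ → ℕ → ℕ
reps zero    m = 1
reps (suc k) m = sum (map term (upTo (suc m)))
  where
  term : ℕ → ℕ
  term j with (2 ^ suc k) * j ≤? m
  ... | yes _ = reps k (m ∸ (2 ^ suc k) * j)
  ... | no  _ = 0

-- Binary partition function b₂(n): representations n = n₀ + 2n₁ + … + 2^t n_t.
-- Parts 2^i with 2^i > n force n_i = 0, so t = n suffices (representations
-- are identified up to trailing zeros).
b₂ : ℕ → ℕ
b₂ n = reps n n

InfinitelyMany : (ℕ → Set) → Set
InfinitelyMany P = ∀ N → ∃ λ n → N ≤ n × P n

{-# OPTIONS --safe #-}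
module Submission where

-- Write a(n) = b₂(2n), so that a(n) = a(n-1) + a(⌊n/2⌋), and let a(n) ≡ 0 (mod k) with k odd.
-- Then a(2n-1) ≡ a(2n) ≡ a(2n+1), and the values of a around 2^(j+1) n form a window of
-- length 2^(j+2) - 1 whose increments are the values in the previous window. Modulo k the
-- windows are therefore determined by their first entries σ₀, σ₁, σ₂, …, which are treated as
-- unknown: whatever they are, one of the first nine windows contains a zero. This is a finite
-- search. The first entry σ₀ is normalised to a divisor of k by scaling, and reflecting the
-- windows roughly halves the number of cases for σ₁.
--
-- In the search, a multiset of residues e is kept as the single number Σ X^e. For given
-- σ₀, …, σᵢ₋₁ an entry of the i-th window has the form e + σᵢ with a known residue e and is
-- represented by X^e, so the negatives of the values of σᵢ that have to be examined further
-- are the positions of the zero digits of this number modulo X^k - 1. Entries of later windows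
-- are sums of a known e and of the products of the later σ's with numbers c₁(t), c₂(t), … that
-- depend only on the position t and are periodic in t; positions with equal c's are merged.
--
-- For 4k the search is restricted to positions where 4 divides a; for n ≥ 1 this happens exactly
-- when the 2-adic valuation of n is odd.

open import Defs
open import Data.Bool using (Bool; true; false; _∧_; _∨_; T; if_then_else_)
open import Data.Empty using (⊥-elim)
open import Data.List using (List; []; _∷_; map; upTo; applyUpTo; take; drop; replicate; length)
open import Data.List.Membership.Propositional.Properties using (∈-upTo⁺)
open import Data.List.Properties using (map-cong; map-upTo; length-map; length-take; length-drop)
open import Data.List.Relation.Unary.All using (All; []; _∷_; lookup)
open import Data.Nat
open import Data.Nat.Coprimality using (Coprime; coprime-divisor; gcd≡1⇒coprime)
open import Data.Nat.Divisibility
  using (_∣_; divides; divides-refl; m%n≡0⇒n∣m; n∣m⇒m%n≡0; ∣m∣n⇒∣m+n; *-monoʳ-∣)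
open import Data.Nat.DivMod
open import Data.Nat.GCD using (gcd)
open import Data.Nat.Induction using (<-rec)
open import Data.Nat.ListAction using (sum)
open import Data.Nat.Properties
open import Algebra.Properties.CommutativeSemigroup +-commutativeSemigroup using (interchange)
open import Data.Nat.Solver using (module +-*-Solver)
open import Data.Product using (∃; ∃₂; _×_; _,_; proj₂)
open import Data.Sum using (_⊎_; inj₁; inj₂)
open import Data.Unit using (⊤; tt)
open import Function using (_∘_)
open import Relation.Binary.Bundles using (Setoid)
open import Relation.Binary.Definitions using (tri<; tri≈; tri>)
open import Relation.Binary.PropositionalEquality
open import Relation.Nullary using (¬_; yes; no)
import Agda.Builtin.Nat as Builtin
import Relation.Binary.Reasoning.Setoid
open Builtin using (mod-helper)

-- Recurrences for representations with bounded parts.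

term : ℕ → ℕ → ℕ → ℕ
term k m j with 2 ^ suc k * j ≤? m
... | yes _ = reps k (m ∸ 2 ^ suc k * j)
... | no  _ = 0

Σ< : (ℕ → ℕ) → ℕ → ℕ
Σ< f zero    = 0
Σ< f (suc n) = f 0 + Σ< (f ∘ suc) n

sum-applyUpTo : ∀ f n → sum (applyUpTo f n) ≡ Σ< f n
sum-applyUpTo f zero    = refl
sum-applyUpTo f (suc n) = cong (f 0 +_) (sum-applyUpTo (f ∘ suc) n)

Σ<-cong : ∀ {f g} n → (∀ j → f j ≡ g j) → Σ< f n ≡ Σ< g n
Σ<-cong zero    f≗g = refl
Σ<-cong (suc n) f≗g = cong₂ _+_ (f≗g 0) (Σ<-cong n (f≗g ∘ suc))

Σ<-zero : ∀ {f} n → (∀ j → f j ≡ 0) → Σ< f n ≡ 0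
Σ<-zero zero    f≗0 = refl
Σ<-zero (suc n) f≗0 = cong₂ _+_ (f≗0 0) (Σ<-zero n (f≗0 ∘ suc))

Σ<-extend : ∀ f n l → (∀ j → n ≤ j → f j ≡ 0) → Σ< f (n + l) ≡ Σ< f n
Σ<-extend f zero    l z = Σ<-zero l (λ j → z j z≤n)
Σ<-extend f (suc n) l z = cong (f 0 +_) (Σ<-extend (f ∘ suc) n l (λ j n≤j → z (suc j) (s≤s n≤j)))

reps-suc : ∀ k m → reps (suc k) m ≡ Σ< (term k m) (suc m)
reps-suc k m = trans (cong sum (trans (map-cong hidden≗term (upTo (suc m))) (map-upTo (term k m) (suc m))))
                     (sum-applyUpTo (term k m) (suc m))
  where
  -- The summand of reps is local to Defs; unification recovers it.
  summand : ∀ {f s} → s ≡ sum (map f (upTo (suc m))) → ℕ → ℕ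
  summand {f} _ = f
  hidden : ℕ → ℕ
  hidden = summand {s = reps (suc k) m} refl
  hidden≗term : ∀ j → hidden j ≡ term k m j
  hidden≗term j with 2 ^ suc k * j ≤? m
  ... | yes _ = refl
  ... | no  _ = refl

term-≤ : ∀ k m j → 2 ^ suc k * j ≤ m → term k m j ≡ reps k (m ∸ 2 ^ suc k * j)
term-≤ k m j p with 2 ^ suc k * j ≤? m
... | yes _ = refl
... | no ¬p = ⊥-elim (¬p p)

term-> : ∀ k m j → m < 2 ^ suc k * j → term k m j ≡ 0
term-> k m j p with 2 ^ suc k * j ≤? m
... | yes q = ⊥-elim (<⇒≱ p q)
... | no _  = refl

term-0 : ∀ k m → term k m 0 ≡ reps k m
term-0 k m = trans (term-≤ k m 0 (subst (_≤ m) (sym (*-zeroʳ (2 ^ suc k))) z≤n))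
                   (cong (λ x → reps k (m ∸ x)) (*-zeroʳ (2 ^ suc k)))

j≤2^k*j : ∀ k j → j ≤ 2 ^ k * j
j≤2^k*j k j = m≤n*m j (2 ^ k) {{m^n≢0 2 k}}

term-big : ∀ k m j → m < j → term k m j ≡ 0
term-big k m j m<j = term-> k m j (<-≤-trans m<j (j≤2^k*j (suc k) j))

term-shift : ∀ k m j → term k (2 ^ suc k + m) (suc j) ≡ term k m j
term-shift k m j with ≤-<-connex (2 ^ suc k * j) m
... | inj₁ p = begin
  term k (h + m) (suc j)             ≡⟨ term-≤ k (h + m) (suc j) (subst (_≤ h + m) (sym (*-suc h j)) (+-monoʳ-≤ h p)) ⟩
  reps k (h + m ∸ h * suc j)         ≡⟨ cong (λ x → reps k (h + m ∸ x)) (*-suc h j) ⟩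
  reps k (h + m ∸ (h + h * j))       ≡⟨ cong (reps k) ([m+n]∸[m+o]≡n∸o h m (h * j)) ⟩
  reps k (m ∸ h * j)                 ≡⟨ sym (term-≤ k m j p) ⟩
  term k m j                         ∎
  where open ≡-Reasoning
        h = 2 ^ suc k
... | inj₂ p = trans (term-> k (h + m) (suc j) (subst (h + m <_) (sym (*-suc h j)) (+-monoʳ-< h p)))
                     (sym (term-> k m j p))
  where h = 2 ^ suc k

reps-< : ∀ k m → m < 2 ^ suc k → reps (suc k) m ≡ reps k m
reps-< k m m<h = begin
  reps (suc k) m                               ≡⟨ reps-suc k m ⟩
  term k m 0 + Σ< (term k m ∘ suc) m           ≡⟨ cong₂ _+_ (term-0 k m) (Σ<-zero m (λ j → term-> k m (suc j) (<-≤-trans m<h (m≤m*n (2 ^ suc k) (suc j))))) ⟩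
  reps k m + 0                                 ≡⟨ +-identityʳ _ ⟩
  reps k m                                     ∎
  where open ≡-Reasoning

-- Representations are split by whether the part 2^(k+1) occurs; if it does, one copy of it is
-- removed.
reps-+ : ∀ k m → reps (suc k) (2 ^ suc k + m) ≡ reps k (2 ^ suc k + m) + reps (suc k) m
reps-+ k m = begin
  reps (suc k) (h + m)                                      ≡⟨ reps-suc k (h + m) ⟩
  term k (h + m) 0 + Σ< (term k (h + m) ∘ suc) (h + m)      ≡⟨ cong₂ _+_ (term-0 k (h + m)) (Σ<-cong (h + m) (term-shift k m)) ⟩
  reps k (h + m) + Σ< (term k m) (h + m)                    ≡⟨ cong (reps k (h + m) +_) (cong (Σ< (term k m)) h+m≡) ⟩
  reps k (h + m) + Σ< (term k m) (suc m + pred h)           ≡⟨ cong (reps k (h + m) +_) (Σ<-extend (term k m) (suc m) (pred h) (term-big k m)) ⟩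
  reps k (h + m) + Σ< (term k m) (suc m)                    ≡⟨ cong (reps k (h + m) +_) (sym (reps-suc k m)) ⟩
  reps k (h + m) + reps (suc k) m                           ∎
  where
  open ≡-Reasoning
  h = 2 ^ suc k
  h+m≡ : h + m ≡ suc m + pred h
  h+m≡ = trans (cong (_+ m) (sym (suc-pred h {{m^n≢0 2 (suc k)}}))) (cong suc (+-comm (pred h) m))

reps-0 : ∀ k → reps k 0 ≡ 1
reps-0 zero    = refl
reps-0 (suc k) = trans (reps-< k 0 (m^n>0 2 (suc k))) (reps-0 k)

double : ℕ → ℕ
double zero    = zero
double (suc n) = suc (suc (double n))

double-+ : ∀ m n → double (m + n) ≡ double m + double n
double-+ zero    n = refl
double-+ (suc m) n = cong (λ x → suc (suc x)) (double-+ m n)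

double≡2* : ∀ n → double n ≡ 2 * n
double≡2* zero    = refl
double≡2* (suc n) = cong suc (trans (cong suc (double≡2* n)) (sym (+-suc n (n + 0))))

double-mono-≤ : ∀ {m n} → m ≤ n → double m ≤ double n
double-mono-≤ z≤n     = z≤n
double-mono-≤ (s≤s p) = s≤s (s≤s (double-mono-≤ p))

-- A representation of an odd number contains a 1, which can be removed. The induction avoids this
-- bijection: it peels off the largest part, for fixed `k` by recursion on `m`.
reps-odd : ∀ k m → reps (suc k) (suc (double m)) ≡ reps (suc k) (double m)
reps-odd zero    zero    = refl
reps-odd zero    (suc m) = trans (reps-+ 0 (suc (double m))) (trans (cong suc (reps-odd zero m)) (sym (reps-+ 0 (double m))))
reps-odd (suc k) = <-rec _ step
  where
  g = 2 ^ suc k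
  h≡ : 2 ^ suc (suc k) ≡ double g
  h≡ = sym (double≡2* g)
  step : ∀ m → (∀ {i} → i < m → reps (2 + k) (suc (double i)) ≡ reps (2 + k) (double i)) →
         reps (2 + k) (suc (double m)) ≡ reps (2 + k) (double m)
  step m ih with ≤-<-connex g m
  ... | inj₂ m<g = trans (reps-< (suc k) (suc (double m)) odd<)
                         (trans (reps-odd k m) (sym (reps-< (suc k) (double m) (<-trans (n<1+n _) odd<))))
    where odd< : suc (double m) < 2 ^ suc (suc k)
          odd< = subst (suc (double m) <_) (sym h≡) (double-mono-≤ m<g)
  ... | inj₁ g≤m with m≤n⇒∃[o]m+o≡n g≤m
  ... | i , refl = begin
    reps (2 + k) (suc (double (g + i)))                    ≡⟨ cong (reps (2 + k)) eq₁ ⟩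
    reps (2 + k) (h + suc (double i))                      ≡⟨ reps-+ (suc k) (suc (double i)) ⟩
    reps (1 + k) (h + suc (double i)) + reps (2 + k) (suc (double i))
      ≡⟨ cong₂ _+_ (trans (cong (reps (1 + k)) (sym eq₁)) (trans (reps-odd k (g + i)) (cong (reps (1 + k)) eq₀))) (ih (m<n+m i (m^n>0 2 (suc k)))) ⟩
    reps (1 + k) (h + double i) + reps (2 + k) (double i)  ≡⟨ sym (reps-+ (suc k) (double i)) ⟩
    reps (2 + k) (h + double i)                            ≡⟨ cong (reps (2 + k)) (sym eq₀) ⟩
    reps (2 + k) (double (g + i))                          ∎
    where
    open ≡-Reasoning
    h = 2 ^ suc (suc k)
    eq₀ : double (g + i) ≡ h + double i
    eq₀ = trans (double-+ g i) (cong (_+ double i) (sym h≡))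
    eq₁ : suc (double (g + i)) ≡ h + suc (double i)
    eq₁ = trans (cong suc eq₀) (sym (+-suc h (double i)))

-- A representation of 2m + 2 either contains two 1's, which can be removed, or contains none, and
-- then all its parts can be halved. The induction again peels off the largest part.
reps-even : ∀ k m → reps (suc k) (double (suc m)) ≡ reps (suc k) (double m) + reps k (suc m)
reps-even zero    m = trans (reps-+ 0 (double m)) (+-comm 1 _)
reps-even (suc k) = <-rec _ step
  where
  g = 2 ^ suc k
  h = 2 ^ suc (suc k)
  h≡ : h ≡ double g
  h≡ = sym (double≡2* g)
  dbl : ∀ i → double (g + i) ≡ h + double i
  dbl i = trans (double-+ g i) (cong (_+ double i) (sym h≡))
  small : ∀ m → m < g → reps (2 + k) (double m) ≡ reps (1 + k) (double m)
  small m m<g = reps-< (suc k) (double m) (subst (double m <_) (sym h≡) (≤-trans (n≤1+n _) (double-mono-≤ m<g)))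
  big : ∀ i → reps (2 + k) (double (g + i)) ≡ reps (1 + k) (double (g + i)) + reps (2 + k) (double i)
  big i = trans (cong (reps (2 + k)) (dbl i)) (trans (reps-+ (suc k) (double i)) (cong (λ x → reps (1 + k) x + reps (2 + k) (double i)) (sym (dbl i))))
  open ≡-Reasoning
  step : ∀ m → (∀ {i} → i < m → reps (2 + k) (double (suc i)) ≡ reps (2 + k) (double i) + reps (1 + k) (suc i)) →
         reps (2 + k) (double (suc m)) ≡ reps (2 + k) (double m) + reps (1 + k) (suc m)
  step m ih with ≤-<-connex g (suc m)
  ... | inj₂ sm<g = begin
    reps (2 + k) (double (suc m))                      ≡⟨ small (suc m) sm<g ⟩
    reps (1 + k) (double (suc m))                      ≡⟨ reps-even k m ⟩
    reps (1 + k) (double m) + reps k (suc m)           ≡⟨ cong₂ _+_ (sym (small m (<-trans (n<1+n m) sm<g))) (sym (reps-< k (suc m) sm<g)) ⟩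
    reps (2 + k) (double m) + reps (1 + k) (suc m)     ∎
  ... | inj₁ g≤sm with m≤n⇒∃[o]m+o≡n g≤sm
  -- Boundary case m + 1 = g: the part `h` fits into 2(m+1) but not into 2m, so it is peeled off on
  -- one side only.
  ... | zero , e = begin
    reps (2 + k) (double (suc m))                      ≡⟨ trans (cong (reps (2 + k) ∘ double) (sym e)) (big 0) ⟩
    reps (1 + k) (double (g + 0)) + reps (2 + k) 0     ≡⟨ cong₂ _+_ (trans (cong (reps (1 + k) ∘ double) e) (reps-even k m)) (trans (reps-0 (2 + k)) (sym (reps-0 (1 + k)))) ⟩
    reps (1 + k) (double m) + reps k (suc m) + reps (1 + k) 0
      ≡⟨ +-assoc (reps (1 + k) (double m)) _ _ ⟩
    reps (1 + k) (double m) + (reps k (suc m) + reps (1 + k) 0)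
      ≡⟨ cong₂ _+_ (sym (small m (subst (suc m ≤_) (+-identityʳ g) (≤-reflexive (sym e))))) (trans (cong (λ x → reps k x + reps (1 + k) 0) (sym e)) (trans (sym (reps-+ k 0)) (cong (reps (1 + k)) e))) ⟩
    reps (2 + k) (double m) + reps (1 + k) (suc m)     ∎
  ... | suc i , e = begin
    reps (2 + k) (double (suc m))
      ≡⟨ trans (cong (reps (2 + k) ∘ double) (sym e)) (big (suc i)) ⟩
    reps (1 + k) (double (g + suc i)) + reps (2 + k) (double (suc i))
      ≡⟨ cong₂ _+_ (trans (cong (reps (1 + k) ∘ double) e) (reps-even k m)) (ih (subst (i <_) m≡ (m<n+m i (m^n>0 2 (suc k))))) ⟩
    reps (1 + k) (double m) + reps k (suc m) + (reps (2 + k) (double i) + reps (1 + k) (suc i))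
      ≡⟨ interchange (reps (1 + k) (double m)) (reps k (suc m)) (reps (2 + k) (double i)) _ ⟩
    reps (1 + k) (double m) + reps (2 + k) (double i) + (reps k (suc m) + reps (1 + k) (suc i))
      ≡⟨ cong₂ _+_ (trans (cong (λ x → reps (1 + k) (double x) + reps (2 + k) (double i)) (sym m≡)) (trans (sym (big i)) (cong (reps (2 + k) ∘ double) m≡)))
                   (trans (cong (λ x → reps k x + reps (1 + k) (suc i)) (sym e)) (trans (sym (reps-+ k (suc i))) (cong (reps (1 + k)) e))) ⟩
    reps (2 + k) (double m) + reps (1 + k) (suc m)     ∎
    where
    m≡ : g + i ≡ m
    m≡ = suc-injective (trans (sym (+-suc g i)) e)

-- The recurrence a(n) = a(n-1) + a(⌊n/2⌋).

n<2^n : ∀ n → n < 2 ^ n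
n<2^n zero    = s≤s z≤n
n<2^n (suc n) = ≤-trans (+-mono-≤ (m^n>0 2 n) (n<2^n n)) (≤-reflexive (cong (2 ^ n +_) (sym (+-identityʳ (2 ^ n)))))

-- Further parts exceed `m`, so they cannot occur.
reps-stable : ∀ k m → reps (k + m) m ≡ b₂ m
reps-stable zero    m = refl
reps-stable (suc k) m = trans (reps-< (k + m) m (≤-<-trans (m≤n+m m (suc k)) (n<2^n _))) (reps-stable k m)

even⊎odd : ∀ n → (n ≡ double ⌊ n /2⌋) ⊎ (n ≡ suc (double ⌊ n /2⌋))
even⊎odd zero          = inj₁ refl
even⊎odd (suc zero)    = inj₂ refl
even⊎odd (suc (suc n)) with even⊎odd n
... | inj₁ e = inj₁ (cong (λ x → suc (suc x)) e)
... | inj₂ e = inj₂ (cong (λ x → suc (suc x)) e)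

abstract

  -- Abstract, so that type checking never unfolds `reps`; the later arguments rest on the equations
  -- of this block alone.
  a : ℕ → ℕ
  a n = b₂ (double n)

  a-b₂ : ∀ n → a n ≡ b₂ (double n)
  a-b₂ n = refl

  a-0 : a 0 ≡ 1
  a-0 = refl

  b₂-odd : ∀ m → b₂ (suc (double m)) ≡ a m
  b₂-odd m = trans (reps-odd (double m) m) (reps-stable 1 (double m))

  b₂-half : ∀ n → b₂ n ≡ a ⌊ n /2⌋
  b₂-half n with even⊎odd n
  ... | inj₁ e = cong b₂ e
  ... | inj₂ e = trans (cong b₂ e) (b₂-odd ⌊ n /2⌋)

  a-suc : ∀ n → a (suc n) ≡ a n + a ⌊ suc n /2⌋
  a-suc n = begin
    reps (2 + double n) (double (suc n))                       ≡⟨ reps-even (1 + double n) n ⟩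
    reps (2 + double n) (double n) + reps (1 + double n) (suc n) ≡⟨ cong₂ _+_ (reps-stable 2 (double n)) (trans (cong (λ k → reps k (suc n)) k≡) (trans (reps-stable n (suc n)) (b₂-half (suc n)))) ⟩
    a n + a ⌊ suc n /2⌋                                        ∎
    where
    open ≡-Reasoning
    k≡ : 1 + double n ≡ n + suc n
    k≡ = trans (cong suc (trans (double≡2* n) (cong (n +_) (+-identityʳ n)))) (sym (+-suc n n))

-- Arithmetic modulo p.

module Congruence (p' : ℕ) where

  p : ℕ
  p = suc p'

  infix 4 _≈_
  -- A record instead of a bare equation of remainders, so that unification can recover `x` and `y`.
  record _≈_ (x y : ℕ) : Set where
    constructor mk
    field %≡ : x % p ≡ y % p
  open _≈_ public

  ≈-refl : ∀ {x} → x ≈ x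
  ≈-refl = mk refl

  ≈-reflexive : ∀ {x y} → x ≡ y → x ≈ y
  ≈-reflexive refl = mk refl

  ≈-sym : ∀ {x y} → x ≈ y → y ≈ x
  ≈-sym (mk e) = mk (sym e)

  ≈-trans : ∀ {x y z} → x ≈ y → y ≈ z → x ≈ z
  ≈-trans (mk e) (mk f) = mk (trans e f)

  ≈-setoid : Setoid _ _
  ≈-setoid = record { Carrier = ℕ ; _≈_ = _≈_
    ; isEquivalence = record { refl = ≈-refl ; sym = ≈-sym ; trans = ≈-trans } }

  module ≈-Reasoning = Relation.Binary.Reasoning.Setoid ≈-setoid

  +-cong-≈ : ∀ {x x' y y'} → x ≈ x' → y ≈ y' → x + y ≈ x' + y'
  +-cong-≈ {x} {x'} {y} {y'} (mk e) (mk f) =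
    mk (trans (%-distribˡ-+ x y p) (trans (cong₂ (λ u v → (u + v) % p) e f) (sym (%-distribˡ-+ x' y' p))))

  *-cong-≈ : ∀ {x x' y y'} → x ≈ x' → y ≈ y' → x * y ≈ x' * y'
  *-cong-≈ {x} {x'} {y} {y'} (mk e) (mk f) =
    mk (trans (%-distribˡ-* x y p) (trans (cong₂ (λ u v → (u * v) % p) e f) (sym (%-distribˡ-* x' y' p))))

  %-≈ : ∀ x → x % p ≈ x
  %-≈ x = mk (m%n%n≡m%n x p)

  p*-≈0 : ∀ x → p * x ≈ 0
  p*-≈0 x = mk (trans (cong (_% p) (*-comm p x)) (m*n%n≡0 x p))

  ∣⇒≈0 : ∀ {x} → p ∣ x → x ≈ 0
  ∣⇒≈0 d = mk (n∣m⇒m%n≡0 _ p d)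

  ≈0⇒∣ : ∀ {x} → x ≈ 0 → p ∣ x
  ≈0⇒∣ (mk e) = m%n≡0⇒n∣m _ p e

  +-cancelʳ-≈ : ∀ {x y} z → x + z ≈ y + z → x ≈ y
  +-cancelʳ-≈ {x} {y} z e = begin
    x                   ≈⟨ absorb x ⟨
    x + z + p' * z      ≈⟨ +-cong-≈ e ≈-refl ⟩
    y + z + p' * z      ≈⟨ absorb y ⟩
    y                   ∎
    where
    open ≈-Reasoning
    -- `p' * z` acts as the negative of `z`.
    absorb : ∀ x → x + z + p' * z ≈ x
    absorb x = begin
      x + z + p' * z    ≡⟨ +-assoc x z (p' * z) ⟩
      x + p * z         ≈⟨ +-cong-≈ (≈-refl {x}) (p*-≈0 z) ⟩
      x + 0             ≡⟨ +-identityʳ x ⟩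
      x                 ∎

  Unit : ℕ → Set
  Unit u = ∃ λ v → v * u ≈ 1

  unit-cancel : ∀ {u x} → Unit u → u * x ≈ 0 → x ≈ 0
  unit-cancel {u} {x} (v , vu≈1) ux≈0 = begin
    x            ≡⟨ *-identityˡ x ⟨
    1 * x        ≈⟨ *-cong-≈ vu≈1 (≈-refl {x}) ⟨
    v * u * x    ≡⟨ *-assoc v u x ⟩
    v * (u * x)  ≈⟨ *-cong-≈ (≈-refl {v}) ux≈0 ⟩
    v * 0        ≡⟨ *-zeroʳ v ⟩
    0            ∎
    where open ≈-Reasoning

  -- p' plays the role of -1.
  p'-unit : Unit p'
  p'-unit = p' , +-cancelʳ-≈ p' (begin
    p' * p' + p'   ≡⟨ +-comm (p' * p') p' ⟩
    p * p'         ≈⟨ p*-≈0 p' ⟩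
    0              ≈⟨ p*-≈0 1 ⟨
    p * 1          ≡⟨ *-identityʳ p ⟩
    1 + p'         ∎)
    where open ≈-Reasoning

-- Increments of windows.

-- D w t = w ⌊0/2⌋ + w ⌊1/2⌋ + … + w ⌊(t-1)/2⌋, so that b₂(2(2m-1+t)) - b₂(2(2m-1)) = D w t
-- for the window w i = b₂(2(m+i)).
D : (ℕ → ℕ) → ℕ → ℕ
D w zero    = 0
D w (suc t) = D w t + w ⌊ t /2⌋

⌊n/2⌋<m : ∀ {n m} → n < 2 * m → ⌊ n /2⌋ < m
⌊n/2⌋<m {zero}        {suc m} _ = s≤s z≤n
⌊n/2⌋<m {suc zero}    {suc m} _ = s≤s z≤n
⌊n/2⌋<m {suc (suc n)} {suc m} (s≤s lt) = s≤s (⌊n/2⌋<m (s≤s⁻¹ (subst (suc n <_) (+-suc m (m + 0)) lt)))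

D-* : ∀ c w t → D (λ i → c * w i) t ≡ c * D w t
D-* c w zero    = sym (*-zeroʳ c)
D-* c w (suc t) = trans (cong (_+ c * w ⌊ t /2⌋) (D-* c w t)) (sym (*-distribˡ-+ c (D w t) _))

D-+ : ∀ v w t → D (λ i → v i + w i) t ≡ D v t + D w t
D-+ v w zero    = refl
D-+ v w (suc t) = trans (cong (_+ (v ⌊ t /2⌋ + w ⌊ t /2⌋)) (D-+ v w t)) (interchange (D v t) (D w t) _ _)

-- Splits off the two increments that come from the first entry; `nextRow` consumes rows in this
-- way.
D-2+ : ∀ w t → D w (2 + t) ≡ w 0 + w 0 + D (w ∘ suc) t
D-2+ w zero    = sym (+-identityʳ _)
D-2+ w (suc t) = trans (cong (_+ w (suc ⌊ t /2⌋)) (D-2+ w t)) (+-assoc (w 0 + w 0) (D (w ∘ suc) t) _)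

⌊2*n∸1∸t/2⌋ : ∀ n t → t < 2 * n → ⌊ 2 * n ∸ suc t /2⌋ ≡ n ∸ suc ⌊ t /2⌋
⌊2*n∸1∸t/2⌋ (suc n) zero lt = trans (cong ⌊_/2⌋ (+-suc n (n + 0))) (half n)
  where half : ∀ n → ⌊ suc (2 * n) /2⌋ ≡ n
        half zero    = refl
        half (suc n) = trans (cong (⌊_/2⌋ ∘ suc ∘ suc) (+-suc n (n + 0))) (cong suc (half n))
⌊2*n∸1∸t/2⌋ (suc n) (suc zero) lt = trans (cong (λ x → ⌊ x ∸ 1 /2⌋) (+-suc n (n + 0))) (half n)
  where half : ∀ n → ⌊ 2 * n /2⌋ ≡ n
        half zero    = refl
        half (suc n) = trans (cong (⌊_/2⌋ ∘ suc) (+-suc n (n + 0))) (cong suc (half n))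
⌊2*n∸1∸t/2⌋ (suc n) (suc (suc t)) (s≤s lt) =
  trans (cong (λ x → ⌊ x ∸ suc (suc t) /2⌋) (+-suc n (n + 0)))
        (⌊2*n∸1∸t/2⌋ n t (s≤s⁻¹ (subst (suc t <_) (+-suc n (n + 0)) lt)))

-- Every entry is used for exactly two increments, so the last `t` increments, read backwards, are
-- the first `t` increments of the reversed window.
D-reverse : ∀ n w t → t ≤ 2 * n → D w (2 * n ∸ t) + D (λ i → w (n ∸ suc i)) t ≡ D w (2 * n)
D-reverse n w zero    _  = +-identityʳ _
D-reverse n w (suc t) lt = begin
  D w (2 * n ∸ suc t) + (D r t + w (n ∸ suc ⌊ t /2⌋))    ≡⟨ cong (λ x → D w (2 * n ∸ suc t) + (D r t + w x)) (⌊2*n∸1∸t/2⌋ n t lt) ⟨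
  D w (2 * n ∸ suc t) + (D r t + w ⌊ 2 * n ∸ suc t /2⌋)  ≡⟨ shuffle (D w (2 * n ∸ suc t)) (D r t) _ ⟩
  D w (suc (2 * n ∸ suc t)) + D r t                      ≡⟨ cong (λ x → D w x + D r t) (suc[m∸suc[n]]≡m∸n lt) ⟩
  D w (2 * n ∸ t) + D r t                                ≡⟨ D-reverse n w t (<⇒≤ lt) ⟩
  D w (2 * n)                                            ∎
  where
  open ≡-Reasoning
  r : ℕ → ℕ
  r i = w (n ∸ suc i)
  suc[m∸suc[n]]≡m∸n : ∀ {m n} → n < m → suc (m ∸ suc n) ≡ m ∸ n
  suc[m∸suc[n]]≡m∸n {m} {n} n<m = sym (+-∸-assoc 1 n<m)
  shuffle : ∀ a b c → a + (b + c) ≡ a + c + b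
  shuffle a b c = trans (cong (a +_) (+-comm b c)) (sym (+-assoc a c b))

-- Plays and their symmetries.

len : ℕ → ℕ
len zero    = 3
len (suc j) = suc (2 * len j)

module Windows (p' : ℕ) (A : ℕ → Bool) (G : Set) where
  open Congruence p'

  D-cong-≈ : ∀ {v w n t} → (∀ i → i < n → v i ≈ w i) → t ≤ 2 * n → D v t ≈ D w t
  D-cong-≈ {t = zero}  v≈w _  = ≈-refl
  D-cong-≈ {t = suc t} v≈w lt = +-cong-≈ (D-cong-≈ v≈w (<⇒≤ lt)) (v≈w _ (⌊n/2⌋<m lt))

  -- `A` marks the positions that count and `G` is the statement to be proved, later the existence
  -- of another zero of the function a. A zero at a marked position thus ends the play.
  record Play : Set where
    field
      W    : ℕ → ℕ → ℕ
      step : ∀ j t → t ≤ 2 * len j → W (suc j) t ≈ W (suc j) 0 + D (W j) t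
      goal : ∀ j t → t < len j → A t ≡ true → W j t ≈ 0 → G
  open Play

  -- The steps are linear, and multiplication by a unit creates no zeros.
  scale : ∀ u → Unit u → Play → Play
  scale u unit S .W j t = u * W S j t
  scale u unit S .step j t t≤ = begin
    u * W S (suc j) t                           ≈⟨ *-cong-≈ (≈-refl {u}) (step S j t t≤) ⟩
    u * (W S (suc j) 0 + D (W S j) t)           ≡⟨ *-distribˡ-+ u _ _ ⟩
    u * W S (suc j) 0 + u * D (W S j) t         ≡⟨ cong (u * W S (suc j) 0 +_) (D-* u (W S j) t) ⟨
    u * W S (suc j) 0 + D (λ i → u * W S j i) t ∎
    where open ≈-Reasoning
  scale u unit S .goal j t t< At ≈0 = goal S j t t< At (unit-cancel unit ≈0)

  Symmetric : Set
  Symmetric = ∀ j t → t < len j → A t ≡ true → A (len j ∸ suc t) ≡ true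

  -- Reading a window backwards changes the sign of its increments.
  reflect : Symmetric → Play → Play
  -- The factor is (-1)^(j+1): each further window contributes one more change of sign.
  reflect A-sym S .W j t = p' ^ suc j * W S j (len j ∸ suc t)
  reflect A-sym S .step j t t≤ = +-cancelʳ-≈ (p' ^ (2 + j) * D r t) (begin
    p' ^ (2 + j) * w (2 * n ∸ t) + p' ^ (2 + j) * D r t      ≡⟨ *-distribˡ-+ (p' ^ (2 + j)) _ _ ⟨
    p' ^ (2 + j) * (w (2 * n ∸ t) + D r t)                   ≈⟨ *-cong-≈ (≈-refl {p' ^ (2 + j)}) mirror ⟩
    p' ^ (2 + j) * w (2 * n)                                 ≡⟨ +-identityʳ _ ⟨
    -- A multiple of `p` is added that splits into the desired increment and the term to be
    -- cancelled.
    p' ^ (2 + j) * w (2 * n) + 0                             ≈⟨ +-cong-≈ (≈-refl {p' ^ (2 + j) * w (2 * n)}) (p*-≈0 (p' ^ (1 + j) * D r t)) ⟨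
    p' ^ (2 + j) * w (2 * n) + p * (p' ^ (1 + j) * D r t)    ≡⟨ sign (p' ^ (2 + j) * w (2 * n)) p' (p' ^ (1 + j)) (D r t) ⟩
    p' ^ (2 + j) * w (2 * n) + p' ^ (1 + j) * D r t + p' ^ (2 + j) * D r t
      ≡⟨ cong (λ x → p' ^ (2 + j) * w (2 * n) + x + p' ^ (2 + j) * D r t) (D-* (p' ^ (1 + j)) r t) ⟨
    p' ^ (2 + j) * w (2 * n) + D (λ i → p' ^ (1 + j) * r i) t + p' ^ (2 + j) * D r t ∎)
    where
    open ≈-Reasoning
    n = len j
    w = W S (suc j)
    r : ℕ → ℕ
    r i = W S j (n ∸ suc i)
    sign : ∀ a b c d → a + suc b * (c * d) ≡ a + c * d + b * c * d
    sign = solve 4 (λ a b c d → a :+ (con 1 :+ b) :* (c :* d) := a :+ c :* d :+ b :* c :* d) refl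
      where open +-*-Solver
    mirror : w (2 * n ∸ t) + D r t ≈ w (2 * n)
    mirror = begin
      w (2 * n ∸ t) + D r t                ≈⟨ +-cong-≈ (step S j (2 * n ∸ t) (m∸n≤m (2 * n) t)) (≈-refl {D r t}) ⟩
      w 0 + D (W S j) (2 * n ∸ t) + D r t  ≡⟨ +-assoc (w 0) _ _ ⟩
      w 0 + (D (W S j) (2 * n ∸ t) + D r t) ≡⟨ cong (w 0 +_) (D-reverse n (W S j) t t≤) ⟩
      w 0 + D (W S j) (2 * n)              ≈⟨ step S j (2 * n) ≤-refl ⟨
      w (2 * n)                            ∎
  reflect A-sym S .goal j t t< At ≈0 =
    goal S j (len j ∸ suc t) (∸-monoʳ-< (s≤s z≤n) t<) (A-sym j t t< At) (cancel (suc j) ≈0)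
    where
    cancel : ∀ k {x} → p' ^ k * x ≈ 0 → x ≈ 0
    cancel zero    {x} e = ≈-trans (≈-reflexive (sym (*-identityˡ x))) e
    cancel (suc k) {x} e = cancel k (unit-cancel p'-unit (≈-trans (≈-reflexive (sym (*-assoc p' (p' ^ k) x))) e))

-- Window entries as linear forms in the first entries.

c : ℕ → ℕ → ℕ
c zero    _ = 1
c (suc k) t = D (c k) t

D^ : ℕ → (ℕ → ℕ) → ℕ → ℕ
D^ zero    w = w
D^ (suc k) w = D (D^ k w)

module Expansion (p' : ℕ) (A : ℕ → Bool) (G : Set) (S : Windows.Play p' A G) where
  open Congruence p'
  open Windows p' A G
  open Play S

  σ : ℕ → ℕ
  σ j = W j 0

  -- res i k t e = e + σᵢ c_k(t) + σᵢ₊₁ c_{k-1}(t) + … + σᵢ₊ₖ c₀(t)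
  res : ℕ → ℕ → ℕ → ℕ → ℕ
  res i zero    t e = e + σ i
  res i (suc k) t e = res (suc i) k t (e + σ i * c (suc k) t)

  res-cong : ∀ i k {t t' e e'} → (∀ j → j ≤ k → c j t ≈ c j t') → e ≈ e' → res i k t e ≈ res i k t' e'
  res-cong i zero    c≈ e≈ = +-cong-≈ e≈ ≈-refl
  res-cong i (suc k) c≈ e≈ = res-cong (suc i) k (λ j j≤k → c≈ j (m≤n⇒m≤1+n j≤k))
                               (+-cong-≈ e≈ (*-cong-≈ (≈-refl {σ i}) (c≈ (suc k) ≤-refl)))

  D-cong : ∀ {v w} → (∀ i → v i ≡ w i) → ∀ t → D v t ≡ D w t
  D-cong v≡w zero    = refl
  D-cong v≡w (suc t) = cong₂ _+_ (D-cong v≡w t) (v≡w _)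

  D^-shift : ∀ k w t → D^ (suc k) w t ≡ D^ k (D w) t
  D^-shift zero    w t = refl
  D^-shift (suc k) w t = D-cong (D^-shift k w) t

  -- `D` is linear, so raising a window by `s` changes position `t`, `k` stages later, by
  -- `s * c k t`. Hence `c k t` is the coefficient of σᵢ in window i + k.
  D^-affine : ∀ k s w t → D^ k (λ i → s + w i) t ≡ D^ k w t + s * c k t
  D^-affine zero    s w t = trans (+-comm s _) (cong (w t +_) (sym (*-identityʳ s)))
  D^-affine (suc k) s w t = begin
    D (D^ k (λ i → s + w i)) t               ≡⟨ D-cong (D^-affine k s w) t ⟩
    D (λ i → D^ k w i + s * c k i) t         ≡⟨ D-+ (D^ k w) (λ i → s * c k i) t ⟩
    D (D^ k w) t + D (λ i → s * c k i) t     ≡⟨ cong (D (D^ k w) t +_) (D-* s (c k) t) ⟩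
    D (D^ k w) t + s * D (c k) t             ∎
    where open ≡-Reasoning

  -- The windows that follow a window w at stage i when the first entries are σ.
  later : ℕ → ℕ → (ℕ → ℕ) → ℕ → ℕ
  later zero    i w = w
  later (suc k) i w = later k (suc i) (λ t → σ (suc i) + D w t)

  later-res : ∀ k i w t → later (suc k) i w t ≡ res (suc i) k t (D^ (suc k) w t)
  later-res zero    i w t = +-comm (σ (suc i)) (D w t)
  later-res (suc k) i w t = trans (later-res k (suc i) (λ t → σ (suc i) + D w t) t)
    (cong (res (2 + i) k t) (trans (D^-affine (suc k) (σ (suc i)) (D w) t)
      (cong (_+ σ (suc i) * c (suc k) t) (sym (D^-shift (suc k) w t)))))

  W-later : ∀ k i w → (∀ t → t < len i → W i t ≈ w t) → ∀ t → t < len (k + i) → W (k + i) t ≈ later k i w t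
  W-later zero    i w W≈w t t< = W≈w t t<
  W-later (suc k) i w W≈w t t< =
    subst (λ m → W m t ≈ later k (suc i) w' t) (+-suc k i)
      (W-later k (suc i) w' (λ t t< → ≈-trans (step i t (s≤s⁻¹ t<)) (+-cong-≈ (≈-refl {σ (suc i)}) (D-cong-≈ W≈w (s≤s⁻¹ t<))))
        t (subst (λ m → t < len m) (sym (+-suc k i)) t<))
    where w' : ℕ → ℕ
          w' t = σ (suc i) + D w t

  D^-const : ∀ k d t → D^ k (λ _ → d) t ≡ d * c k t
  D^-const zero    d t = sym (*-identityʳ d)
  D^-const (suc k) d t = trans (D-cong (D^-const k d) t) (D-* d (c k) t)

  -- If window 0 is constant, iterating `D` on it gives multiples of `c`; this is the part of an
  -- entry that is known before σ₁ is chosen.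
  W-res : ∀ d → (∀ t → t < 3 → W 0 t ≈ d) → ∀ k t → t < len (suc k) → W (suc k) t ≈ res 1 k t (d * c (suc k) t)
  W-res d W₀≈d k t t< = ≈-trans (subst (λ m → W m t ≈ later (suc k) 0 (λ _ → d) t) (+-identityʳ (suc k))
      (W-later (suc k) 0 (λ _ → d) W₀≈d t (subst (λ m → t < len m) (sym (+-identityʳ (suc k))) t<)))
    (≈-reflexive (trans (later-res k 0 (λ _ → d) t) (cong (res 1 k t) (D^-const (suc k) d t))))

-- The search program.

data Row : Set where
  []   : Row
  cell : (a b c d : ℕ) → Row → Row

-- Multiplying Σ X^e by X^y adds y to every residue; the sum over the row unites the multisets of
-- all positions.
dot : Row → Row → ℕ
dot (cell a b c d r) (cell a' b' c' d' r') = a * a' + (b * b' + (c * c' + (d * d' + dot r r')))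
dot _ _ = 0

mulR : Row → Row → Row
mulR (cell a b c d r) (cell a' b' c' d' r') = cell (a * a') (b * b') (c * c') (d * d') (mulR r r')
mulR _ _ = []

addR : Row → Row → Row
addR (cell a b c d r) (cell a' b' c' d' r') = cell (a + a') (b + b') (c + c') (d + d') (addR r r')
addR [] r' = r'
addR r  [] = r

-- Fused, so that evaluation builds no intermediate rows.
mulAddR : Row → Row → Row → Row → Row
mulAddR (cell a b c d r) (cell a' b' c' d' r') (cell x y z w q) (cell x' y' z' w' q') =
  cell (a * a' + x * x') (b * b' + y * y') (c * c' + z * z') (d * d' + w * w') (mulAddR r r' q q')
mulAddR r r' q q' = addR (mulR r r') (mulR q q')

-- The l-th element of a Tree (suc j) holds the positions l * P j, …, (l + 1) * P j - 1 for the
-- period P j; rows are lists cut into cells of four, and positions may be missing at the end.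
Tree : ℕ → Set
Tree zero    = Row
Tree (suc j) = List (Tree j)

mulT : ∀ j → Tree j → Tree j → Tree j
mulT zero    r        r'         = mulR r r'
mulT (suc j) (t ∷ ts) (t' ∷ ts') = mulT j t t' ∷ mulT (suc j) ts ts'
mulT (suc j) _        _          = []

addT : ∀ j → Tree j → Tree j → Tree j
addT zero    r        r'         = addR r r'
addT (suc j) (t ∷ ts) (t' ∷ ts') = addT j t t' ∷ addT (suc j) ts ts'
addT (suc j) []       ts'        = ts'
addT (suc j) ts       []         = ts

mulAddT : ∀ j → Tree j → Tree j → Tree j → Tree j → Tree j
mulAddT zero    r r' q q' = mulAddR r r' q q'
mulAddT (suc j) (t ∷ ts) (t' ∷ ts') (u ∷ us) (u' ∷ us') = mulAddT j t t' u u' ∷ mulAddT (suc j) ts ts' us us'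
mulAddT (suc j) ts ts' us us' = addT (suc j) (mulT (suc j) ts ts') (mulT (suc j) us us')

empty : ∀ j → Tree j
empty zero    = []
empty (suc j) = []

-- Adds the contribution of the σ just fixed, then merges positions that differ by multiples of
-- `P j`. The coefficients needed afterwards are c₀, ..., c_{j+1}, which agree at such positions.
collapse : ∀ j → Tree (suc j) → Tree (suc j) → Tree j
collapse j (t ∷ [])          (t' ∷ _)        = mulT j t t'
collapse j (t ∷ u ∷ [])      (t' ∷ u' ∷ _)   = mulAddT j t t' u u'
collapse j (t ∷ ts@(_ ∷ _))  (t' ∷ ts')      = addT j (mulT j t t') (collapse j ts ts')
collapse j _                 _               = empty j

infixr 5 _∷_
-- At stage i, the tree of index j in a list of type `Levels 0` holds the known parts of window i +
-- j + 1. For window i itself positions no longer matter, and a single number suffices.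
data Levels (j : ℕ) : Set where
  []  : Levels j
  _∷_ : Tree j → Levels (suc j) → Levels j

child : ∀ {j} → Levels (suc j) → Levels (suc j) → Levels j
child {j} (m ∷ ms) (t ∷ ts) = collapse j m t ∷ child ms ts
child     _        _        = []

-- Digit r of a number is nonzero iff X ^ r - 1 < v % X ^ (r + 1); the mᵢ are the numbers X ^ r - 1.
-- The table for digit r holds the powers X ^ (s * cⱼ(t)) for s = k - r. The number q supplies
-- nonzero digits beyond the k-th, since digits are tested in blocks of seven.
data Seven : Set where
  seven : (t₀ t₁ t₂ t₃ t₄ t₅ t₆ : Levels 0) → Seven

data Tables : Set where
  []    : Tables
  block : Seven → (m₀ m₁ m₂ m₃ m₄ m₅ m₆ m₇ : ℕ) → Tables → Tables

data Env : Set where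
  env : (n q : ℕ) → Tables → Env

mutual
  node : Env → ℕ → ℕ → Levels 0 → Bool
  node e zero M ms = false
  node e@(env n q ts) (suc f) M ms = scan e f ms (q + mod-helper 0 n M n) ts

  scan : Env → ℕ → Levels 0 → ℕ → Tables → Bool
  -- In use, `n + 1` is X^p - 1, so the remainder of `M` has its exponents reduced modulo p.
  scan e f ms v [] = true
  scan e f ms v (block ts m₀ m₁ m₂ m₃ m₄ m₅ m₆ m₇ us) =
    branch (m₀ Builtin.< mod-helper 0 m₁ v m₁) (m₁ Builtin.< mod-helper 0 m₂ v m₂)
           (m₂ Builtin.< mod-helper 0 m₃ v m₃) (m₃ Builtin.< mod-helper 0 m₄ v m₄)
           (m₄ Builtin.< mod-helper 0 m₅ v m₅) (m₅ Builtin.< mod-helper 0 m₆ v m₆)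
           (m₆ Builtin.< mod-helper 0 m₇ v m₇) e f ms ts v us

  -- The first clause passes over a block in which no value of σ is open, without touching its
  -- tables.
  branch : (b₀ b₁ b₂ b₃ b₄ b₅ b₆ : Bool) → Env → ℕ → Levels 0 → Seven → ℕ → Tables → Bool
  branch true true true true true true true e f ms ts v us = scan e f ms v us
  branch b₀ b₁ b₂ b₃ b₄ b₅ b₆ e f ms (seven t₀ t₁ t₂ t₃ t₄ t₅ t₆) v us =
    digit b₀ e f ms t₀ ∧ digit b₁ e f ms t₁ ∧ digit b₂ e f ms t₂ ∧ digit b₃ e f ms t₃ ∧
    digit b₄ e f ms t₄ ∧ digit b₅ e f ms t₅ ∧ digit b₆ e f ms t₆ ∧ scan e f ms v us

  digit : Bool → Env → ℕ → Levels 0 → Levels 0 → Bool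
  digit true  e f ms       t        = true
  digit false e f (m ∷ ms) (t ∷ ts) = node e f (dot m t) (child ms ts)
  digit false e f _        _        = false

-- Tables for the search.

rowOf : List ℕ → Row
rowOf []                   = []
rowOf (a ∷ [])             = cell a 0 0 0 []
rowOf (a ∷ b ∷ [])         = cell a b 0 0 []
rowOf (a ∷ b ∷ c ∷ [])     = cell a b c 0 []
rowOf (a ∷ b ∷ c ∷ d ∷ xs) = cell a b c d (rowOf xs)

-- The second number is fuel. Running out of it would only drop positions, which makes the search
-- weaker but keeps it sound.
treeOf : (ℕ → ℕ) → ∀ j → ℕ → List ℕ → Tree j
treeOf P zero    f       xs         = rowOf xs
treeOf P (suc j) zero    xs         = []
treeOf P (suc j) (suc f) []         = []
treeOf P (suc j) (suc f) xs@(_ ∷ _) = treeOf P j f (take (P j) xs) ∷ treeOf P (suc j) f (drop (P j) xs)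

nth : ℕ → List ℕ → ℕ → ℕ
nth d []       i       = d
nth d (x ∷ xs) zero    = x
nth d (x ∷ xs) (suc i) = nth d xs i

-- Two entries per step, since each entry of the old row serves for two increments. `f` bounds the
-- length; an odd `f` gives exactly `f` entries if the old row is long enough.
nextRow : ℕ → ℕ → ℕ → List ℕ → List ℕ
nextRow p' (suc (suc f)) a (w ∷ ws) = a ∷ (a + w) % suc p' ∷ nextRow p' f ((a + (w + w)) % suc p') ws
nextRow p' _             a _        = a ∷ []

rows : ℕ → ℕ → ℕ → List ℕ → List (List ℕ)
rows p' f zero    ws = []
rows p' f (suc k) ws = ws ∷ rows p' f k (nextRow p' f 0 ws)

powersOf : ℕ → List ℕ → ℕ → List ℕ → List ℕ
powersOf p' pw s = map (λ x → nth 0 pw ((s * x) % suc p'))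

table : (ℕ → ℕ) → ℕ → List ℕ → ℕ → ∀ j → List (List ℕ) → Levels j
table P p' pw s j []       = []
table P p' pw s j (c ∷ cs) = treeOf P j 1100 (powersOf p' pw s c) ∷ table P p' pw s (suc j) cs

tables : (ℕ → ℕ) → ℕ → ℕ → List ℕ → List (List ℕ) → ℕ → ℕ → Tables
tables P X p' pw cs r zero    = []
tables P X p' pw cs r (suc k) =
  block (seven (t r) (t (1 + r)) (t (2 + r)) (t (3 + r)) (t (4 + r)) (t (5 + r)) (t (6 + r)))
    (m r) (m (1 + r)) (m (2 + r)) (m (3 + r)) (m (4 + r)) (m (5 + r)) (m (6 + r)) (m (7 + r))
    (tables P X p' pw cs (7 + r) k)
  where
  t : ℕ → Levels 0
  t r = table P p' pw (suc p' ∸ r) 0 cs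
  m : ℕ → ℕ
  m r = X ^ r ∸ 1

mask : (ℕ → Bool) → ℕ → List ℕ → List ℕ
mask A t []       = []
mask A t (x ∷ xs) = (if A t then x else 0) ∷ mask A (suc t) xs

-- The state when only σ₀ = d is known: index j belongs to window j + 2, cut to its length.
-- Positions that do not count become 0, the empty multiset.
rootLevels : (ℕ → Bool) → (ℕ → ℕ) → ℕ → List ℕ → ℕ → ∀ j → List (List ℕ) → Levels j
rootLevels A P p' pw d j []       = []
rootLevels A P p' pw d j (c ∷ cs) =
  treeOf P j 1100 (mask A 0 (take (len (2 + j)) (powersOf p' pw d c))) ∷ rootLevels A P p' pw d (suc j) cs

prefix : List ℕ → List ℕ → Bool
prefix []       ys       = true
prefix (x ∷ xs) []       = false
prefix (x ∷ xs) (y ∷ ys) = (x ≡ᵇ y) ∧ prefix xs ys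

-- The row at index j is c_{j+1}. Its period is tested on the first `Z` positions, the only ones
-- that occur in the search.
periodic : (ℕ → ℕ) → ℕ → ℕ → List (List ℕ) → Bool
periodic P Z j []       = true
periodic P Z j (c ∷ cs) = (Z ≡ᵇ length c) ∧ prefix (drop (P j) c) c ∧ periodic P Z (suc j) cs

-- The quotients of successive periods are 2 beyond the end of the list bs.
period : ℕ → List ℕ → ℕ → ℕ
period p bs zero    = p
period p bs (suc j) = nth 2 bs j * period p bs j

ones : ℕ → ℕ → ℕ
ones X zero    = 0
ones X (suc k) = 1 + X * ones X k

envOf : (ℕ → ℕ) → (X p' : ℕ) → List ℕ → List (List ℕ) → Env
-- The blocks of seven cover the digits below p and at most six more; the seven ones above X^p make
-- those nonzero.
envOf P X p' pw cs = env (X ^ suc p' ∸ 2) (X ^ suc p' * ones X 7) (tables P X p' pw cs 0 (suc (p' / 7)))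

digits : Env → (ℕ → ℕ) → ℕ → List ℕ → List (List ℕ) → Levels 0 → List ℕ → Bool
digits e P p' pw cs ms []       = true
-- Window 1 is treated by `hits`, so the search starts by fixing σ₁ = s. The fuel 20 exceeds the
-- seven levels for windows 2 to 8.
digits e P p' pw cs ms (s ∷ ss) = digit false e 20 ms (table P p' pw s 0 cs) ∧ digits e P p' pw cs ms ss

search : (ℕ → Bool) → (ℕ → ℕ) → (X Z p' d : ℕ) → List ℕ → List ℕ → List (List ℕ) → Bool
search A P X Z p' d reps pw []       = false
search A P X Z p' d reps pw (c₁ ∷ cs) =
  periodic P Z 0 (c₁ ∷ cs) ∧
  digits (envOf P X p' pw (c₁ ∷ cs)) P p' pw (c₁ ∷ cs) (rootLevels A P p' pw d 0 cs) reps

-- The rows are c₁, ..., c₈, cut to `Z` positions. For `Z` = 1023 = `len 8` all nine windows are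
-- complete; for `Z` = 255 = `len 6` the last two are truncated.
verify : (ℕ → Bool) → (X Z p' : ℕ) → List ℕ → (d : ℕ) → List ℕ → Bool
verify A X Z p' bs d reps =
  search A (period (suc p') bs) X Z p' d reps (map (X ^_) (upTo (suc p'))) (rows p' Z 8 (nextRow p' Z 0 (replicate Z 1)))

-- Multisets of residues as numbers in base X.

module Sums (X : ℕ) where

  -- M is a sum of at most k powers X ^ e with e in P.
  data Sum (P : ℕ → Set) : ℕ → ℕ → Set where
    []  : ∀ {k} → Sum P k 0
    _∷_ : ∀ {k e M} → P e → Sum P k M → Sum P (suc k) (X ^ e + M)

  -- `none` accounts for masked positions and for the padding of rows.
  data Power (P : ℕ → Set) : ℕ → Set where
    none  : Power P 0
    power : ∀ {e} → P e → Power P (X ^ e)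

  sum-≤ : ∀ {P k l M} → k ≤ l → Sum P k M → Sum P l M
  sum-≤ k≤l       []       = []
  sum-≤ (s≤s k≤l) (x ∷ xs) = x ∷ sum-≤ k≤l xs

  sum-+ : ∀ {P k l M L} → Sum P k M → Sum P l L → Sum P (k + l) (M + L)
  sum-+ {k = k} []       ys = sum-≤ (m≤n+m _ k) ys
  sum-+ {P} {L = L} (_∷_ {k} {e} {M} x xs) ys = subst (Sum P _) (sym (+-assoc (X ^ e) M L)) (x ∷ sum-+ xs ys)

  sum-* : ∀ {P Q R : ℕ → Set} {k M x} → (∀ {e y} → P e → Q y → R (e + y)) → Sum P k M → Power Q x → Sum R k (M * x)
  sum-* {R = R} {M = M} f xs none = subst (Sum R _) (sym (*-zeroʳ M)) []
  sum-* f []       (power y) = []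
  sum-* {R = R} f (_∷_ {e = e} {M} x xs) (power {y'} y) =
    subst (Sum R _) (sym (trans (*-distribʳ-+ (X ^ y') (X ^ e) M) (cong (_+ M * X ^ y') (sym (^-distribˡ-+-* X e y')))))
      (f x y ∷ sum-* f xs (power y))

  sum-1 : ∀ {P x} → Power P x → Sum P 1 x
  sum-1 none                = []
  sum-1 (power {e} x) = subst (Sum _ 1) (+-identityʳ (X ^ e)) (x ∷ [])

module Coverage (X p' n : ℕ) (2≤X : 2 ≤ X) (1≤p' : 1 ≤ p') (2+n≡X^p : 2 + n ≡ X ^ suc p') where
  open Sums X

  p N : ℕ
  p = suc p'
  N = suc n

  instance
    X≢0 : NonZero X
    X≢0 = >-nonZero (≤-trans (s≤s z≤n) 2≤X)

  Residue : (ℕ → Set) → ℕ → Set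
  Residue P r = r < p × ∃ λ e → P e × e % p ≡ r

  X^p%N : X ^ p % N ≡ 1 % N
  X^p%N = trans (cong (_% N) (sym 2+n≡X^p)) ([m+n]%n≡m%n 1 N)

  X^[q*p]%N : ∀ q → X ^ (q * p) % N ≡ 1 % N
  X^[q*p]%N zero    = refl
  X^[q*p]%N (suc q) = begin
    X ^ (p + q * p) % N                        ≡⟨ cong (_% N) (^-distribˡ-+-* X p (q * p)) ⟩
    X ^ p * X ^ (q * p) % N                    ≡⟨ %-distribˡ-* (X ^ p) (X ^ (q * p)) N ⟩
    (X ^ p % N) * (X ^ (q * p) % N) % N        ≡⟨ cong₂ (λ x y → x * y % N) X^p%N (X^[q*p]%N q) ⟩
    (1 % N) * (1 % N) % N                      ≡⟨ %-distribˡ-* 1 1 N ⟨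
    1 % N                                      ∎
    where open ≡-Reasoning

  X^%N : ∀ e → X ^ e % N ≡ X ^ (e % p) % N
  X^%N e = begin
    X ^ e % N                                        ≡⟨ cong (λ x → X ^ x % N) (m≡m%n+[m/n]*n e p) ⟩
    X ^ (e % p + e / p * p) % N                      ≡⟨ cong (_% N) (^-distribˡ-+-* X (e % p) (e / p * p)) ⟩
    X ^ (e % p) * X ^ (e / p * p) % N                ≡⟨ %-distribˡ-* (X ^ (e % p)) (X ^ (e / p * p)) N ⟩
    (X ^ (e % p) % N) * (X ^ (e / p * p) % N) % N    ≡⟨ cong (λ x → (X ^ (e % p) % N) * x % N) (X^[q*p]%N (e / p)) ⟩
    (X ^ (e % p) % N) * (1 % N) % N                  ≡⟨ %-distribˡ-* (X ^ (e % p)) 1 N ⟨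
    X ^ (e % p) * 1 % N                              ≡⟨ cong (_% N) (*-identityʳ (X ^ (e % p))) ⟩
    X ^ (e % p) % N                                  ∎
    where open ≡-Reasoning

  residues : ∀ {P k M} → Sum P k M → ∃ λ R → Sum (Residue P) k R × M % N ≡ R % N
  residues []       = 0 , [] , refl
  residues (_∷_ {e = e} {M} x xs) with residues xs
  ... | R , ys , M≡R = X ^ (e % p) + R , (m%n<n e p , e , x , refl) ∷ ys ,
    trans (%-distribˡ-+ (X ^ e) M N) (trans (cong₂ (λ u v → (u + v) % N) (X^%N e) M≡R) (sym (%-distribˡ-+ (X ^ (e % p)) R N)))

  X^r*X≤ : ∀ {r s} → r < s → X ^ r * X ≤ X ^ s
  X^r*X≤ {r} {s} r<s = subst (_≤ X ^ s) (*-comm X (X ^ r)) (^-monoʳ-≤ X r<s)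

  residues-≤ : ∀ {P k R} → Sum (Residue P) k R → R * X ≤ k * X ^ p
  residues-≤ []       = z≤n
  residues-≤ (_∷_ {k} {e} {M} (r<p , _) xs) = subst (_≤ suc k * X ^ p) (sym (*-distribʳ-+ X (X ^ e) M))
    (+-mono-≤ (X^r*X≤ r<p) (residues-≤ xs))

  -- Fewer than X powers, none above X^(p-1), add up to less than N = X^p - 1, so reduction modulo N
  -- leaves the sum of the reduced powers intact.
  residues-<N : ∀ {P k R} → k < X → Sum (Residue P) k R → R < N
  residues-<N {k = k} {R} k<X xs = s≤s⁻¹ (subst (2 + R ≤_) (sym 2+n≡X^p) (*-cancelʳ-≤ (2 + R) (X ^ p) X (begin
    (2 + R) * X          ≡⟨ *-distribʳ-+ X 2 R ⟩
    2 * X + R * X        ≤⟨ +-mono-≤ (≤-trans (*-monoˡ-≤ X 2≤X) (≤-trans (≤-reflexive (cong (X *_) (sym (*-identityʳ X)))) (^-monoʳ-≤ X (s≤s 1≤p')))) (residues-≤ xs) ⟩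
    X ^ p + k * X ^ p    ≤⟨ *-monoˡ-≤ (X ^ p) k<X ⟩
    X * X ^ p            ≡⟨ *-comm X (X ^ p) ⟩
    X ^ p * X            ∎)))
    where open ≤-Reasoning

  -- If no exponent is r, the sum consists of higher powers and of at most k powers below X^r. For k
  -- < X the latter cannot carry into digit r, which is then zero.
  split : ∀ {P k R} r → Sum (Residue P) k R →
          (∃ λ e → P e × e % p ≡ r) ⊎ (∃₂ λ low high → R ≡ low + high * X ^ suc r × low * X ≤ k * X ^ r)
  split r [] = inj₂ (0 , 0 , refl , z≤n)
  split r (_∷_ {k} {s} {M} (_ , e , Pe , e≡s) xs) with <-cmp s r | split r xs
  ... | tri≈ _ refl _ | _ = inj₁ (e , Pe , e≡s)
  ... | _             | inj₁ found = inj₁ found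
  ... | tri< s<r _ _  | inj₂ (low , high , eq , ≤k) = inj₂ (X ^ s + low , high ,
        trans (cong (X ^ s +_) eq) (sym (+-assoc (X ^ s) low _)) ,
        subst (_≤ suc k * X ^ r) (sym (*-distribʳ-+ X (X ^ s) low)) (+-mono-≤ (X^r*X≤ s<r) ≤k))
  ... | tri> _ _ r<s  | inj₂ (low , high , eq , ≤k) with m≤n⇒∃[o]m+o≡n r<s
  ... | o , refl = inj₂ (low , X ^ o + high ,
        trans (cong₂ _+_ (^-distribˡ-+-* X (suc r) o) eq) (regroup (X ^ suc r) (X ^ o) low high) ,
        ≤-trans ≤k (m≤n+m _ _))
    where
    regroup : ∀ a b c d → a * b + (c + d * a) ≡ c + (b + d) * a
    regroup = solve 4 (λ a b c d → a :* b :+ (c :+ d :* a) := c :+ (b :+ d) :* a) refl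
      where open +-*-Solver

  covered : ∀ {P k M} → Sum P k M → k < X → ∀ q r {m m'} → r < p → m ≡ X ^ r ∸ 1 → m' ≡ X ^ suc r ∸ 1 →
            (m <ᵇ (X ^ p * q + M % N) % suc m') ≡ true → ∃ λ e → P e × e % p ≡ r
  covered {k = k} {M} xs k<X q r {m} {m'} r<p m≡ m'≡ nonzero with residues xs
  ... | R , ys , M≡R with split r ys
  ... | inj₁ found = found
  ... | inj₂ (low , high , eq , ≤k) = ⊥-elim (<-irrefl refl (<-≤-trans low<X^r X^r≤low))
    where
    open ≡-Reasoning
    low<X^r : low < X ^ r
    low<X^r = *-cancelʳ-< X low (X ^ r) (≤-<-trans ≤k (subst (k * X ^ r <_) (*-comm X (X ^ r)) (*-monoˡ-< (X ^ r) {{m^n≢0 X r}} k<X)))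
    suc-m' : suc m' ≡ X ^ suc r
    suc-m' = trans (cong suc m'≡) (suc-pred (X ^ suc r) {{m^n≢0 X (suc r)}})
    value : (X ^ p * q + M % N) % suc m' ≡ low
    value with m≤n⇒∃[o]m+o≡n r<p
    ... | o , r+o≡p = begin
      (X ^ p * q + M % N) % suc m'                         ≡⟨ cong (λ x → (X ^ p * q + x) % suc m') (trans M≡R (m<n⇒m%n≡m (residues-<N k<X ys))) ⟩
      (X ^ p * q + R) % suc m'                             ≡⟨ cong (_% suc m') (cong₂ (λ x y → x * q + y) (trans (cong (X ^_) (sym r+o≡p)) (^-distribˡ-+-* X (suc r) o)) eq) ⟩
      (X ^ suc r * X ^ o * q + (low + high * X ^ suc r)) % suc m' ≡⟨ cong (_% suc m') (regroup (X ^ suc r) (X ^ o) q low high) ⟩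
      (low + (X ^ o * q + high) * X ^ suc r) % suc m'      ≡⟨ cong (λ x → (low + (X ^ o * q + high) * x) % suc m') suc-m' ⟨
      (low + (X ^ o * q + high) * suc m') % suc m'         ≡⟨ [m+kn]%n≡m%n low (X ^ o * q + high) (suc m') ⟩
      low % suc m'                                         ≡⟨ m<n⇒m%n≡m (subst (low <_) (sym suc-m') (<-≤-trans low<X^r (^-monoʳ-≤ X (n≤1+n r)))) ⟩
      low                                                  ∎
      where
      regroup : ∀ a b c d e → a * b * c + (d + e * a) ≡ d + (b * c + e) * a
      regroup = solve 5 (λ a b c d e → a :* b :* c :+ (d :+ e :* a) := d :+ (b :* c :+ e) :* a) refl
        where open +-*-Solver
    X^r≤low : X ^ r ≤ low
    X^r≤low = subst (_≤ low) (trans (cong suc m≡) (suc-pred (X ^ r) {{m^n≢0 X r}}))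
                (subst (m <_) value (<ᵇ⇒< m _ (subst T (sym nonzero) tt)))

-- Invariants of rows and trees.

Family : Set₁
Family = ℕ → ℕ → Set

infixl 6 _after_
_after_ : Family → ℕ → Family
(F after n) t = F (n + t)

Fits : Family → Family → Family → Set
Fits F G H = ∀ t {e y} → F t e → G t y → H t (e + y)

module Forms (X : ℕ) (P : ℕ → ℕ) where
  open Sums X

  -- The entry of the row at position t is a sum of powers X ^ e with F t e, at most k in the whole row.
  data SumRow (F : Family) (k : ℕ) : Row → Set where
    []   : SumRow F k []
    cell : ∀ {a b c d r k₀ k₁ k₂ k₃ k₄} → Sum (F 0) k₀ a → Sum (F 1) k₁ b → Sum (F 2) k₂ c → Sum (F 3) k₃ d →
           SumRow (F after 4) k₄ r → k₀ + (k₁ + (k₂ + (k₃ + k₄))) ≤ k → SumRow F k (cell a b c d r)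

  data PowerRow (F : Family) : Row → Set where
    []   : PowerRow F []
    cell : ∀ {a b c d r} → Power (F 0) a → Power (F 1) b → Power (F 2) c → Power (F 3) d →
           PowerRow (F after 4) r → PowerRow F (cell a b c d r)

  SumTree : ∀ j → Family → ℕ → Tree j → Set
  SumTree zero    F k r        = SumRow F k r
  SumTree (suc j) F k []       = ⊤
  SumTree (suc j) F k (t ∷ ts) = ∃₂ λ k₁ k₂ → k₁ + k₂ ≤ k × SumTree j F k₁ t × SumTree (suc j) (F after P j) k₂ ts

  PowerTree : ∀ j → Family → Tree j → Set
  PowerTree zero    F r        = PowerRow F r
  PowerTree (suc j) F []       = ⊤
  PowerTree (suc j) F (t ∷ ts) = PowerTree j F t × PowerTree (suc j) (F after P j) ts

  dot-sum : ∀ {F G k r r'} {Q : ℕ → Set} → Fits F G (λ _ → Q) → SumRow F k r → PowerRow G r' → Sum Q k (dot r r')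
  dot-sum fits []                      _  = []
  dot-sum fits (cell _ _ _ _ _ _)      [] = []
  dot-sum fits (cell a b c d r k≤) (cell a' b' c' d' r') =
    sum-≤ k≤ (sum-+ (sum-* (fits 0) a a') (sum-+ (sum-* (fits 1) b b') (sum-+ (sum-* (fits 2) c c') (sum-+ (sum-* (fits 3) d d')
      (dot-sum (λ t → fits (4 + t)) r r')))))

  sumRow-≤ : ∀ {F k l r} → k ≤ l → SumRow F k r → SumRow F l r
  sumRow-≤ k≤l []                  = []
  sumRow-≤ k≤l (cell a b c d r k≤) = cell a b c d r (≤-trans k≤ k≤l)

  sumTree-≤ : ∀ j {F k l} t → k ≤ l → SumTree j F k t → SumTree j F l t
  sumTree-≤ zero    t        k≤l v                     = sumRow-≤ k≤l v
  sumTree-≤ (suc j) []       k≤l v                     = tt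
  sumTree-≤ (suc j) (t ∷ ts) k≤l (k₁ , k₂ , k≤ , v , vs) = k₁ , k₂ , ≤-trans k≤ k≤l , v , vs

  mulR-sum : ∀ {F G H k r r'} → Fits F G H → SumRow F k r → PowerRow G r' → SumRow H k (mulR r r')
  mulR-sum fits []                 _  = []
  mulR-sum fits (cell _ _ _ _ _ _) [] = []
  mulR-sum fits (cell a b c d r k≤) (cell a' b' c' d' r') =
    cell (sum-* (fits 0) a a') (sum-* (fits 1) b b') (sum-* (fits 2) c c') (sum-* (fits 3) d d')
      (mulR-sum (λ t → fits (4 + t)) r r') k≤

  addR-sum : ∀ {F k l r r'} → SumRow F k r → SumRow F l r' → SumRow F (k + l) (addR r r')
  addR-sum {k = k} [] v = sumRow-≤ (m≤n+m _ k) v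
  addR-sum (cell a b c d r k≤) [] = cell a b c d r (≤-trans k≤ (m≤m+n _ _))
  addR-sum (cell {k₀ = k₀} {k₁} {k₂} {k₃} {k₄} a b c d r k≤) (cell {k₀ = l₀} {l₁} {l₂} {l₃} {l₄} a' b' c' d' r' l≤) =
    cell (sum-+ a a') (sum-+ b b') (sum-+ c c') (sum-+ d d') (addR-sum r r') (≤-trans (≤-reflexive regroup) (+-mono-≤ k≤ l≤))
    where
    regroup : (k₀ + l₀) + ((k₁ + l₁) + ((k₂ + l₂) + ((k₃ + l₃) + (k₄ + l₄)))) ≡
              (k₀ + (k₁ + (k₂ + (k₃ + k₄)))) + (l₀ + (l₁ + (l₂ + (l₃ + l₄))))
    regroup = trans (cong ((k₀ + l₀) +_) (trans (cong ((k₁ + l₁) +_) (trans (cong ((k₂ + l₂) +_) (interchange k₃ l₃ k₄ l₄))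
      (interchange k₂ l₂ _ _))) (interchange k₁ l₁ _ _))) (interchange k₀ l₀ _ _)

  mulT-sum : ∀ j {F G H k} t t' → Fits F G H → SumTree j F k t → PowerTree j G t' → SumTree j H k (mulT j t t')
  mulT-sum zero    t        t'         fits v v' = mulR-sum fits v v'
  mulT-sum (suc j) []       t'         fits v v' = tt
  mulT-sum (suc j) (t ∷ ts) []         fits v v' = tt
  mulT-sum (suc j) (t ∷ ts) (t' ∷ ts') fits (k₁ , k₂ , k≤ , v , vs) (v' , vs') =
    k₁ , k₂ , k≤ , mulT-sum j t t' fits v v' , mulT-sum (suc j) ts ts' (λ i → fits (P j + i)) vs vs'

  addT-sum : ∀ j {F k l} t t' → SumTree j F k t → SumTree j F l t' → SumTree j F (k + l) (addT j t t')
  addT-sum zero            t        t'         v v' = addR-sum v v'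
  addT-sum (suc j) {k = k} []       t'         v v' = sumTree-≤ (suc j) t' (m≤n+m _ k) v'
  addT-sum (suc j) {k = k} (t ∷ ts) []         v v' = sumTree-≤ (suc j) (t ∷ ts) (m≤m+n k _) v
  addT-sum (suc j) (t ∷ ts) (t' ∷ ts') (k₁ , k₂ , k≤ , v , vs) (l₁ , l₂ , l≤ , v' , vs') =
    k₁ + l₁ , k₂ + l₂ , ≤-trans (≤-reflexive (interchange k₁ l₁ k₂ l₂)) (+-mono-≤ k≤ l≤) ,
    addT-sum j t t' v v' , addT-sum (suc j) ts ts' vs vs'

  mulAddR≡ : ∀ r r' q q' → mulAddR r r' q q' ≡ addR (mulR r r') (mulR q q')
  mulAddR≡ (cell a b c d r) (cell a' b' c' d' r') (cell x y z w q) (cell x' y' z' w' q') =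
    cong (cell _ _ _ _) (mulAddR≡ r r' q q')
  mulAddR≡ []                 _                   _                 _  = refl
  mulAddR≡ (cell _ _ _ _ _)   []                  _                 _  = refl
  mulAddR≡ (cell _ _ _ _ _)   (cell _ _ _ _ _)    []                _  = refl
  mulAddR≡ (cell _ _ _ _ _)   (cell _ _ _ _ _)    (cell _ _ _ _ _)  [] = refl

  mulAddT≡ : ∀ j t t' u u' → mulAddT j t t' u u' ≡ addT j (mulT j t t') (mulT j u u')
  mulAddT≡ zero    t        t'         u        u'         = mulAddR≡ t t' u u'
  mulAddT≡ (suc j) (t ∷ ts) (t' ∷ ts') (u ∷ us) (u' ∷ us') = cong₂ _∷_ (mulAddT≡ j t t' u u') (mulAddT≡ (suc j) ts ts' us us')
  mulAddT≡ (suc j) []       _          _        _          = refl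
  mulAddT≡ (suc j) (_ ∷ _)  []         _        _          = refl
  mulAddT≡ (suc j) (_ ∷ _)  (_ ∷ _)    []       _          = refl
  mulAddT≡ (suc j) (_ ∷ _)  (_ ∷ _)    (_ ∷ _)  []         = refl

  -- Folds the positions l * P j + t for all l onto t.
  FoldFits : ℕ → Family → Family → Family → Set
  FoldFits j F G H = ∀ l t {e y} → F (l * P j + t) e → G (l * P j + t) y → H t (e + y)

  foldFits-after : ∀ j {F G H} → FoldFits j F G H → FoldFits j (F after P j) (G after P j) H
  foldFits-after j {F} {G} {H} fits l t {e} {y} f g =
    fits (suc l) t (subst (λ i → F i e) (sym (+-assoc (P j) (l * P j) t)) f) (subst (λ i → G i y) (sym (+-assoc (P j) (l * P j) t)) g)

  empty-sum : ∀ j {F k} → SumTree j F k (empty j)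
  empty-sum zero    = []
  empty-sum (suc j) = tt

  -- Merging creates no new powers, so the bound on their number, which prevents carries, is
  -- inherited from the root.
  collapse-sum : ∀ j {F G H k} t t' → FoldFits j F G H → SumTree (suc j) F k t → PowerTree (suc j) G t' → SumTree j H k (collapse j t t')
  collapse-sum j []               _         fits v v' = empty-sum j
  collapse-sum j (t ∷ [])         []        fits v v' = empty-sum j
  collapse-sum j (t ∷ u ∷ [])     []        fits v v' = empty-sum j
  collapse-sum j (t ∷ u ∷ w ∷ ts) []        fits v v' = empty-sum j
  collapse-sum j (t ∷ [])         (t' ∷ ts') fits (k₁ , k₂ , k≤ , v , vs) (v' , _) =
    sumTree-≤ j _ (≤-trans (m≤m+n k₁ k₂) k≤) (mulT-sum j t t' (fits 0) v v')
  collapse-sum j (t ∷ u ∷ []) (t' ∷ []) fits (k₁ , k₂ , k≤ , v , vs) (v' , vs') =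
    sumTree-≤ j _ k≤ (addT-sum j (mulT j t t') (empty j) (mulT-sum j t t' (fits 0) v v') (empty-sum j))
  collapse-sum j {F} {G} {H} (t ∷ u ∷ []) (t' ∷ u' ∷ ts') fits (k₁ , k₂ , k≤ , v , vs) (v' , vs') =
    sumTree-≤ j _ k≤ (subst (SumTree j H (k₁ + k₂)) (sym (mulAddT≡ j t t' u u'))
      (addT-sum j (mulT j t t') (mulT j u u') (mulT-sum j t t' (fits 0) v v')
        (collapse-sum j (u ∷ []) (u' ∷ ts') (foldFits-after j {F} {G} {H} fits) vs vs')))
  collapse-sum j {F} {G} {H} (t ∷ u ∷ w ∷ ts) (t' ∷ ts') fits (k₁ , k₂ , k≤ , v , vs) (v' , vs') =
    sumTree-≤ j _ k≤ (addT-sum j (mulT j t t') (collapse j (u ∷ w ∷ ts) ts') (mulT-sum j t t' (fits 0) v v')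
      (collapse-sum j (u ∷ w ∷ ts) ts' (foldFits-after j {F} {G} {H} fits) vs vs'))

∧-elim : ∀ {a b} → a ∧ b ≡ true → a ≡ true × b ≡ true
∧-elim {true} e = refl , e

-- Soundness of the search.

module Soundness (X p' : ℕ) (2≤X : 2 ≤ X) (1≤p' : 1 ≤ p') (Z : ℕ) (P : ℕ → ℕ)
                 (A : ℕ → Bool) (G : Set) (S : Windows.Play p' A G) where
  open Congruence p' using (_≈_; mk; %≡; ≈-refl; ≈-sym; ≈-trans; ≈-reflexive; +-cong-≈; *-cong-≈; %-≈; p*-≈0; +-cancelʳ-≈; module ≈-Reasoning)
  open Expansion p' A G S
  open Sums X
  open Forms X P

  p : ℕ
  p = suc p'

  -- An exponent with this property yields a zero if the walk continues along σ.
  Wins : ℕ → ℕ → Family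
  Wins i k t e = res i k t e ≈ 0 → G

  -- `t < Z` is recorded because periods are known only for these positions.
  Multiplier : ℕ → ℕ → Family
  Multiplier s k t y = t < Z × y ≈ s * c k t

  Periodic : ℕ → Set
  Periodic j = ∀ l t k → k ≤ suc j → l * P j + t < Z → c k (l * P j + t) ≈ c k t

  PeriodicBelow : ℕ → Set
  PeriodicBelow zero    = ⊤
  PeriodicBelow (suc j) = Periodic j

  SumLevels : ℕ → ∀ j → Levels j → Set
  SumLevels i j []       = ⊤
  SumLevels i j (m ∷ ms) = (∃ λ k → k < X × SumTree j (Wins i (suc j)) k m) × SumLevels i (suc j) ms

  PowerLevels : ℕ → ∀ j → Levels j → Set
  PowerLevels s j []       = ⊤
  PowerLevels s j (t ∷ ts) = PowerTree j (Multiplier s (suc j)) t × PeriodicBelow j × PowerLevels s (suc j) ts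

  -- A win depends on the position only through the coefficients still to be used, and by
  -- periodicity these agree at all positions folded onto `t`.
  child-sum : ∀ {i s} j ms ts → s ≈ σ i → SumLevels i (suc j) ms → PowerLevels s (suc j) ts → SumLevels (suc i) j (child ms ts)
  child-sum j []       ts       s≈ v w = tt
  child-sum j (m ∷ ms) []       s≈ v w = tt
  child-sum {i} {s} j (m ∷ ms) (t ∷ ts) s≈ ((k , k<X , v) , vs) (w , per , ws) =
    (k , k<X , collapse-sum j {Wins i (2 + j)} {Multiplier s (2 + j)} {Wins (suc i) (suc j)} m t fits v w) , child-sum (suc j) ms ts s≈ vs ws
    where
    fits : FoldFits j (Wins i (2 + j)) (Multiplier s (2 + j)) (Wins (suc i) (suc j))
    fits l t win (t<Z , y≈) ≈0 = win (≈-trans (res-cong (suc i) (suc j) (λ k k≤ → per l t k k≤ t<Z)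
      (+-cong-≈ ≈-refl (≈-sym (≈-trans y≈ (*-cong-≈ s≈ ≈-refl))))) ≈0)

  dot-wins : ∀ {i s k} m t → s ≈ σ i → SumTree 0 (Wins i 1) k m → PowerTree 0 (Multiplier s 1) t → Sum (Wins (suc i) 0 0) k (dot m t)
  dot-wins {i} {s} m t s≈ v w = dot-sum {Wins i 1} {Multiplier s 1} fits v w
    where
    fits : Fits (Wins i 1) (Multiplier s 1) (λ _ → Wins (suc i) 0 0)
    fits t {x} win (_ , y≈) ≈0 = win (≈-trans (+-cong-≈ (+-cong-≈ (≈-refl {x}) (≈-sym (≈-trans y≈ (*-cong-≈ s≈ ≈-refl)))) (≈-refl {σ (suc i)})) ≈0)

  Cutoff : ℕ → ℕ → Set
  Cutoff r m = m ≡ X ^ r ∸ 1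

  PowerTables : ℕ → Tables → Set
  PowerTables r [] = p ≤ r
  PowerTables r (block (seven t₀ t₁ t₂ t₃ t₄ t₅ t₆) m₀ m₁ m₂ m₃ m₄ m₅ m₆ m₇ us) =
    (L r t₀ × L (1 + r) t₁ × L (2 + r) t₂ × L (3 + r) t₃ × L (4 + r) t₄ × L (5 + r) t₅ × L (6 + r) t₆) ×
    (Cutoff r m₀ × Cutoff (1 + r) m₁ × Cutoff (2 + r) m₂ × Cutoff (3 + r) m₃ × Cutoff (4 + r) m₄ × Cutoff (5 + r) m₅ × Cutoff (6 + r) m₆ × Cutoff (7 + r) m₇) ×
    PowerTables (7 + r) us
    where L : ℕ → Levels 0 → Set
          L r t = PowerLevels (p ∸ r) 0 t

  branch-∧ : ∀ b₀ b₁ b₂ b₃ b₄ b₅ b₆ {e f ms t₀ t₁ t₂ t₃ t₄ t₅ t₆ v us} →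
    branch b₀ b₁ b₂ b₃ b₄ b₅ b₆ e f ms (seven t₀ t₁ t₂ t₃ t₄ t₅ t₆) v us ≡
    (digit b₀ e f ms t₀ ∧ digit b₁ e f ms t₁ ∧ digit b₂ e f ms t₂ ∧ digit b₃ e f ms t₃ ∧
     digit b₄ e f ms t₄ ∧ digit b₅ e f ms t₅ ∧ digit b₆ e f ms t₆ ∧ scan e f ms v us)
  branch-∧ false _     _     _     _     _     _     = refl
  branch-∧ true  false _     _     _     _     _     = refl
  branch-∧ true  true  false _     _     _     _     = refl
  branch-∧ true  true  true  false _     _     _     = refl
  branch-∧ true  true  true  true  false _     _     = refl
  branch-∧ true  true  true  true  true  false _     = refl
  branch-∧ true  true  true  true  true  true  false = refl
  branch-∧ true  true  true  true  true  true  true  = refl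

  module _ (n q : ℕ) (us : Tables) (2+n≡X^p : 2 + n ≡ X ^ p) (us-powers : PowerTables 0 us) where
    open Coverage X p' n 2≤X 1≤p' 2+n≡X^p using (covered)

    e : Env
    e = env n (X ^ p * q) us

    -- The program has checked every branch, but the proof follows only the branch of the actual σ.
    Sound : ℕ → Set
    Sound f = ∀ i M ms → (∃ λ k → k < X × Sum (Wins i 0 0) k M) → SumLevels i 0 ms → node e f M ms ≡ true → G

    digit-sound : ∀ {f} → Sound f → ∀ {i s b} ms t → s ≈ σ i → SumLevels i 0 ms → PowerLevels s 0 t → (b ≡ true → G) →
                  digit b e f ms t ≡ true → G
    digit-sound IH {b = true}  ms       t        s≈ v w hit _ = hit refl
    digit-sound IH {i} {b = false} (m ∷ ms) (t ∷ ts) s≈ ((k , k<X , v) , vs) (w , _ , ws) hit ok =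
      IH (suc i) (dot m t) (child ms ts) (k , k<X , dot-wins m t s≈ v w) (child-sum 0 ms ts s≈ vs ws) ok

    -- `o + r₀` is the digit that belongs to -σᵢ, and `o` is its distance from the start of the
    -- current block.
    scan-sound : ∀ {f} → Sound f → ∀ {i M k} ms → k < X → Sum (Wins i 0 0) k M → SumLevels i 0 ms →
                 ∀ ts o r₀ → PowerTables r₀ ts → o + r₀ < p → o + r₀ + σ i ≈ 0 →
                 scan e f ms (X ^ p * q + M % suc n) ts ≡ true → G
    scan-sound IH ms k<X xs v [] o r₀ p≤r₀ r<p r≈ ok = ⊥-elim (<-irrefl refl (<-≤-trans r<p (≤-trans p≤r₀ (m≤n+m r₀ o))))
    scan-sound {f} IH {i} {M} ms k<X xs v (block (seven t₀ t₁ t₂ t₃ t₄ t₅ t₆) m₀ m₁ m₂ m₃ m₄ m₅ m₆ m₇ ts) o r₀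
      ((w₀ , w₁ , w₂ , w₃ , w₄ , w₅ , w₆) , (μ₀ , μ₁ , μ₂ , μ₃ , μ₄ , μ₅ , μ₆ , μ₇) , ws) r<p r≈ ok
      with ∧-elim (trans (sym (branch-∧ (b m₀ m₁) (b m₁ m₂) (b m₂ m₃) (b m₃ m₄) (b m₄ m₅) (b m₅ m₆) (b m₆ m₇))) ok)
      where b : ℕ → ℕ → Bool
            b m m' = m <ᵇ (X ^ p * q + M % suc n) % suc m'
    ... | d₀ , rest₁ with ∧-elim rest₁
    ... | d₁ , rest₂ with ∧-elim rest₂
    ... | d₂ , rest₃ with ∧-elim rest₃
    ... | d₃ , rest₄ with ∧-elim rest₄
    ... | d₄ , rest₅ with ∧-elim rest₅
    ... | d₅ , rest₆ with ∧-elim rest₆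
    ... | d₆ , rest₇ = select o r<p r≈
      where
      one : ∀ r {m m'} t → PowerLevels (p ∸ r) 0 t → Cutoff r m → Cutoff (suc r) m' → r < p → r + σ i ≈ 0 →
            digit (m <ᵇ (X ^ p * q + M % suc n) % suc m') e f ms t ≡ true → G
      one r t w μ μ' r<p r≈ = digit-sound IH ms t (+-cancelʳ-≈ r (begin
          p ∸ r + r    ≡⟨ m∸n+n≡m (<⇒≤ r<p) ⟩
          p            ≡⟨ *-identityʳ p ⟨
          p * 1        ≈⟨ p*-≈0 1 ⟩
          0            ≈⟨ r≈ ⟨
          r + σ i      ≡⟨ +-comm r (σ i) ⟩
          σ i + r      ∎)) v w hit
        where
        open ≈-Reasoning
        hit : _ → G
        hit nonzero with covered xs k<X q r r<p μ μ' nonzero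
        ... | x , win , x%p≡r = win (≈-trans (+-cong-≈ (≈-trans (≈-sym (%-≈ x)) (≈-reflexive x%p≡r)) ≈-refl) r≈)
      select : ∀ o → o + r₀ < p → o + r₀ + σ i ≈ 0 → G
      select 0 r<p r≈ = one r₀ t₀ w₀ μ₀ μ₁ r<p r≈ d₀
      select 1 r<p r≈ = one (1 + r₀) t₁ w₁ μ₁ μ₂ r<p r≈ d₁
      select 2 r<p r≈ = one (2 + r₀) t₂ w₂ μ₂ μ₃ r<p r≈ d₂
      select 3 r<p r≈ = one (3 + r₀) t₃ w₃ μ₃ μ₄ r<p r≈ d₃
      select 4 r<p r≈ = one (4 + r₀) t₄ w₄ μ₄ μ₅ r<p r≈ d₄
      select 5 r<p r≈ = one (5 + r₀) t₅ w₅ μ₅ μ₆ r<p r≈ d₅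
      select 6 r<p r≈ = one (6 + r₀) t₆ w₆ μ₆ μ₇ r<p r≈ d₆
      select (suc (suc (suc (suc (suc (suc (suc o))))))) r<p r≈ =
        scan-sound IH ms k<X xs v ts o (7 + r₀) ws (subst (_< p) eq r<p) (subst (λ x → x + σ i ≈ 0) eq r≈) rest₇
        where eq : 7 + o + r₀ ≡ o + (7 + r₀)
              eq = trans (cong (_+ r₀) (+-comm 7 o)) (+-assoc o 7 r₀)

    node-sound : ∀ f → Sound f
    node-sound (suc f) i M ms (k , k<X , xs) v ok =
      -- The decisive digit is r ≡ -σᵢ. If it is nonzero, some entry e + σᵢ vanishes; otherwise the
      -- search has gone on with p - r ≡ σᵢ.
      scan-sound (node-sound f) ms k<X xs v us r 0 us-powers (subst (_< p) (sym (+-identityʳ r)) (m%n<n (p' * σ i) p)) (begin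
        r + 0 + σ i        ≡⟨ cong (_+ σ i) (+-identityʳ r) ⟩
        r + σ i            ≈⟨ +-cong-≈ (%-≈ (p' * σ i)) ≈-refl ⟩
        p' * σ i + σ i     ≡⟨ +-comm (p' * σ i) (σ i) ⟩
        p * σ i            ≈⟨ p*-≈0 (σ i) ⟩
        0                  ∎) ok
      where
      open ≈-Reasoning
      r : ℕ
      r = (p' * σ i) % p

-- Lists and the trees built from them.

At : Family → List ℕ → Set
At R []       = ⊤
At R (x ∷ xs) = R 0 x × At (R after 1) xs

at-map : ∀ {R R'} (g : ℕ → ℕ) → (∀ t {x} → R t x → R' t (g x)) → ∀ xs → At R xs → At R' (map g xs)
at-map g h []       rs       = tt
at-map g h (x ∷ xs) (r , rs) = h 0 r , at-map g (λ t → h (suc t)) xs rs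

at-weaken : ∀ {R R'} → (∀ t {x} → R t x → R' t x) → ∀ xs → At R xs → At R' xs
at-weaken h []       rs       = tt
at-weaken h (x ∷ xs) (r , rs) = h 0 r , at-weaken (λ t → h (suc t)) xs rs

at-take : ∀ {R} n xs → At R xs → At (λ t x → t < n × R t x) (take n xs)
at-take zero    xs       rs       = tt
at-take (suc n) []       rs       = tt
at-take (suc n) (x ∷ xs) (r , rs) = (s≤s z≤n , r) , at-weaken (λ t (t<n , r) → s≤s t<n , r) (take n xs) (at-take n xs rs)

at-length : ∀ {R} xs → At R xs → At (λ t x → t < length xs × R t x) xs
at-length []       rs       = tt
at-length (x ∷ xs) (r , rs) = (s≤s z≤n , r) , at-weaken (λ t (t<n , r) → s≤s t<n , r) xs (at-length xs rs)

at-drop : ∀ {R} n xs → At R xs → At (R after n) (drop n xs)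
at-drop zero    xs       rs       = rs
at-drop (suc n) []       rs       = tt
at-drop (suc n) (x ∷ xs) (r , rs) = at-drop n xs rs

at-lookup : ∀ {R} xs t → At R xs → t < length xs → ∃ (R t)
at-lookup (x ∷ xs) zero    (r , rs) t<       = x , r
at-lookup (x ∷ xs) (suc t) (r , rs) (s≤s t<) = at-lookup xs t rs t<

at-replicate : ∀ {R} n {x} → (∀ t → R t x) → At R (replicate n x)
at-replicate zero    r = tt
at-replicate (suc n) r = r 0 , at-replicate n (λ t → r (suc t))

≡true⇒T : ∀ {b} → b ≡ true → T b
≡true⇒T refl = tt

≡ᵇ-sound : ∀ {m n} → (m ≡ᵇ n) ≡ true → m ≡ n
≡ᵇ-sound {m} {n} e = ≡ᵇ⇒≡ m n (≡true⇒T e)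

prefix-sound : ∀ {R R'} xs ys → prefix xs ys ≡ true → At R xs → At R' ys → At (λ t x → R t x × R' t x) xs
prefix-sound []       ys       e rs       rs' = tt
prefix-sound {R' = R'} (x ∷ xs) (y ∷ ys) e (r , rs) (r' , rs') with ∧-elim e
... | x≡y , e' = (r , subst (R' 0) (sym (≡ᵇ-sound x≡y)) r') , prefix-sound xs ys e' rs rs'

module Building (X : ℕ) (P : ℕ → ℕ) where
  open Sums X
  open Forms X P

  Powers : Family → Family
  Powers F t = Power (F t)

  rowOf-power : ∀ {F} xs → At (Powers F) xs → PowerRow F (rowOf xs)
  rowOf-power []                   _                      = []
  rowOf-power (a ∷ [])             (u , _)                = cell u none none none []
  rowOf-power (a ∷ b ∷ [])         (u , v , _)            = cell u v none none []
  rowOf-power (a ∷ b ∷ c ∷ [])     (u , v , w , _)        = cell u v w none []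
  rowOf-power (a ∷ b ∷ c ∷ d ∷ xs) (u , v , w , z , rest) = cell u v w z (rowOf-power xs rest)

  rowOf-sum : ∀ {F} xs → At (Powers F) xs → SumRow F (length xs) (rowOf xs)
  rowOf-sum []                   _                      = []
  rowOf-sum (a ∷ [])             (u , _)                = cell (sum-1 u) ([] {k = 0}) ([] {k = 0}) ([] {k = 0}) ([] {k = 0}) ≤-refl
  rowOf-sum (a ∷ b ∷ [])         (u , v , _)            = cell (sum-1 u) (sum-1 v) ([] {k = 0}) ([] {k = 0}) ([] {k = 0}) ≤-refl
  rowOf-sum (a ∷ b ∷ c ∷ [])     (u , v , w , _)        = cell (sum-1 u) (sum-1 v) (sum-1 w) ([] {k = 0}) ([] {k = 0}) ≤-refl
  rowOf-sum (a ∷ b ∷ c ∷ d ∷ xs) (u , v , w , z , rest) = cell (sum-1 u) (sum-1 v) (sum-1 w) (sum-1 z) (rowOf-sum xs rest) ≤-refl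

  at-forget : ∀ {F n} xs → At (λ t x → t < n × Powers F t x) xs → At (Powers F) xs
  at-forget xs = at-weaken (λ t → proj₂) xs

  treeOf-power : ∀ j f {F} xs → At (Powers F) xs → PowerTree j F (treeOf P j f xs)
  treeOf-power zero    f       xs         v = rowOf-power xs v
  treeOf-power (suc j) zero    xs         v = tt
  treeOf-power (suc j) (suc f) []         v = tt
  treeOf-power (suc j) (suc f) {F} xs@(_ ∷ _) v =
    treeOf-power j f (take (P j) xs) (at-forget (take (P j) xs) (at-take (P j) xs v)) , treeOf-power (suc j) f (drop (P j) xs) (at-drop {Powers F} (P j) xs v)

  treeOf-sum : ∀ j f {F} xs → At (Powers F) xs → SumTree j F (length xs) (treeOf P j f xs)
  treeOf-sum zero    f       xs         v = rowOf-sum xs v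
  treeOf-sum (suc j) zero    xs         v = tt
  treeOf-sum (suc j) (suc f) []         v = tt
  treeOf-sum (suc j) (suc f) {F} xs@(_ ∷ _) v =
    length (take (P j) xs) , length (drop (P j) xs) , ≤-reflexive lengths ,
    treeOf-sum j f (take (P j) xs) (at-forget (take (P j) xs) (at-take (P j) xs v)) , treeOf-sum (suc j) f (drop (P j) xs) (at-drop {Powers F} (P j) xs v)
    where
    lengths : length (take (P j) xs) + length (drop (P j) xs) ≡ length xs
    lengths = trans (cong₂ _+_ (length-take (P j) xs) (length-drop (P j) xs)) (m⊓n+n∸m≡n (P j) (length xs))

  nth-power : ∀ (g : ℕ → ℕ) n i → Power (_≡ g i) (nth 0 (map (X ^_) (applyUpTo g n)) i)
  nth-power g zero    i       = none
  nth-power g (suc n) zero    = power refl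
  nth-power g (suc n) (suc i) = nth-power (g ∘ suc) n i

  power-map : ∀ {Q Q' : ℕ → Set} {x} → (∀ {e} → Q e → Q' e) → Power Q x → Power Q' x
  power-map h none      = none
  power-map h (power q) = power (h q)

  mask-power : ∀ A t₀ {F} xs → At (Powers F) xs → At (Powers (λ t e → A (t₀ + t) ≡ true × F t e)) (mask A t₀ xs)
  mask-power A t₀ []       v        = tt
  mask-power A t₀ {F} (x ∷ xs) (v , vs) = first (A t₀) refl ,
    subst (λ f → At f (mask A (suc t₀) xs)) refl
      (at-weaken (λ t → power-map (λ (At , Fe) → trans (cong A (+-suc t₀ t)) At , Fe)) _ (mask-power A (suc t₀) xs vs))
    where
    first : ∀ b → A t₀ ≡ b → Power (λ e → A (t₀ + 0) ≡ true × F 0 e) (if b then x else 0)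
    first true  e = power-map (λ f → trans (cong A (+-identityʳ t₀)) e , f) v
    first false e = none

  length-mask : ∀ A t xs → length (mask A t xs) ≡ length xs
  length-mask A t []       = refl
  length-mask A t (x ∷ xs) = cong suc (length-mask A (suc t) xs)

∨-elim : ∀ {a b} → a ∨ b ≡ true → a ≡ true ⊎ b ≡ true
∨-elim {true}  _ = inj₁ refl
∨-elim {false} e = inj₂ e

module Rows (p' : ℕ) where
  open Congruence p'

  nextRow-represents : ∀ f {w} a A ws → a ≈ A → At (λ t x → x ≈ w t) ws → At (λ t x → x ≈ A + D w t) (nextRow p' f a ws)
  nextRow-represents zero          a A ws       a≈A v = ≈-trans a≈A (≈-reflexive (sym (+-identityʳ A))) , tt
  nextRow-represents (suc zero)    a A ws       a≈A v = ≈-trans a≈A (≈-reflexive (sym (+-identityʳ A))) , tt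
  nextRow-represents (suc (suc f)) a A []       a≈A v = ≈-trans a≈A (≈-reflexive (sym (+-identityʳ A))) , tt
  nextRow-represents (suc (suc f)) {w} a A (x ∷ ws) a≈A (x≈ , v) =
    ≈-trans a≈A (≈-reflexive (sym (+-identityʳ A))) ,
    ≈-trans (%-≈ (a + x)) (+-cong-≈ a≈A x≈) ,
    at-weaken (λ t e → ≈-trans e (≈-reflexive (trans (+-assoc A (w 0 + w 0) _) (cong (A +_) (sym (D-2+ w t)))))) _
      (nextRow-represents f ((a + (x + x)) % p) (A + (w 0 + w 0)) ws
        (≈-trans (%-≈ (a + (x + x))) (+-cong-≈ a≈A (+-cong-≈ x≈ x≈))) v)

-- Reduction of the cases for σ₀ and σ₁.

elem : ℕ → List ℕ → Bool
elem x []       = false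
elem x (y ∷ ys) = (x ≡ᵇ y) ∨ elem x ys

anyBelow allBelow : (ℕ → Bool) → ℕ → Bool
anyBelow f zero    = false
anyBelow f (suc n) = f n ∨ anyBelow f n
allBelow f zero    = true
allBelow f (suc n) = f n ∧ allBelow f n

isUnit : ℕ → ℕ → Bool
isUnit p' u = anyBelow (λ v → (v * u) % suc p' ≡ᵇ 1 % suc p') (suc p')

-- Since window 0 is constant, window 1 is the arithmetic progression s + d t with t < 7.
hits : (ℕ → Bool) → ℕ → ℕ → ℕ → Bool
hits A p' d s = anyBelow (λ t → (t <ᵇ 7) ∧ A t ∧ ((s + d * t) % suc p' ≡ᵇ 0 % suc p')) 7

complete : (ℕ → Bool) → (p' d : ℕ) → List ℕ → Bool
complete A p' d reps = allBelow (λ s → hits A p' d s ∨ anyBelow (λ u → orbit s u ∧ isUnit p' u) (suc p')) (suc p')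
  where
  orbit : ℕ → ℕ → Bool
  orbit s u = (((u * d) % suc p' ≡ᵇ d % suc p') ∧ elem ((u * s) % suc p') reps) ∨
              -- Reflection turns σ₀ = d into -d and σ₁ into the last entry s + 6d of window 1; the
              -- unit u has to bring -d back to d.
              (((u * d + d) % suc p' ≡ᵇ 0 % suc p') ∧ elem ((u * (s + d * 6)) % suc p') reps)

-- The possible values d of σ₀ up to units, each with representatives for σ₁.
Roots : Set
Roots = List (ℕ × List ℕ)

allRoots : (ℕ → Bool) → (X Z p' : ℕ) → List ℕ → Roots → Bool
allRoots A X Z p' bs []                   = true
allRoots A X Z p' bs ((d , reps) ∷ roots) = (verify A X Z p' bs d reps ∧ complete A p' d reps) ∧ allRoots A X Z p' bs roots

reachable : ℕ → ℕ → Roots → Bool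
reachable p' x []                = false
reachable p' x ((d , _) ∷ roots) = (x % suc p' ≡ᵇ d % suc p') ∨ reachable p' x roots

clears : (ℕ → Bool) → (X Z p' : ℕ) → List ℕ → Roots → Bool
clears A X Z p' bs roots =
  allBelow (λ s → (s ≡ᵇ 0) ∨ anyBelow (λ u → reachable p' (u * s) roots ∧ isUnit p' u) (suc p')) (suc p') ∧
  allRoots A X Z p' bs roots

-- Correctness of the tables.

module Search (X p' : ℕ) (2≤X : 2 ≤ X) (1≤p' : 1 ≤ p') (Z : ℕ) (Z<X : Z < X) (P : ℕ → ℕ)
              (P-∣ : ∀ j → ∃ λ b → P (suc j) ≡ b * P j) (A : ℕ → Bool) (G : Set) (S : Windows.Play p' A G) where
  open Congruence p' hiding (p)
  open Windows p' A G using (module Play)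
  open Play S using (W; goal)
  open Expansion p' A G S
  open Sums X
  open Forms X P
  open Building X P
  open Rows p'
  open Soundness X p' 2≤X 1≤p' Z P A G S

  pw : List ℕ
  pw = map (X ^_) (upTo p)

  Represents : ℕ → List ℕ → Set
  Represents k = At (λ t x → x ≈ c k t)

  AllRepresent : ℕ → List (List ℕ) → Set
  AllRepresent k []       = ⊤
  AllRepresent k (r ∷ rs) = Represents k r × AllRepresent (suc k) rs

  powersOf-power : ∀ s k xs → Represents k xs → At (Powers (λ t e → e ≈ s * c k t)) (powersOf p' pw s xs)
  powersOf-power s k xs = at-map _ (λ t {x} x≈ → power-map
    (λ e≡ → ≈-trans (≈-reflexive e≡) (≈-trans (%-≈ (s * x)) (*-cong-≈ (≈-refl {s}) x≈))) (nth-power (λ i → i) p ((s * x) % p))) xs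

  at-resize : ∀ {R : Family} {m n} xs → m ≡ n → At (λ t x → t < m × R t x) xs → At (λ t x → t < n × R t x) xs
  at-resize xs refl v = v

  -- The new row is tested directly; for the earlier coefficients, `P j` is a multiple of the
  -- preceding period.
  periodic-step : ∀ j → PeriodicBelow j → ∀ xs → Represents (suc j) xs → Z ≡ length xs →
                  prefix (drop (P j) xs) xs ≡ true → Periodic j
  periodic-step j below xs rep len≡ pre l t k k≤ lt with m≤n⇒m<n∨m≡n k≤
  ... | inj₁ (s≤s k≤j) = lower j below k≤j lt
    where
    lower : ∀ j → PeriodicBelow j → k ≤ j → l * P j + t < Z → c k (l * P j + t) ≈ c k t
    lower zero    _     z≤n lt = ≈-refl
    lower (suc j) below k≤j lt with P-∣ j
    ... | b , eq = subst (λ x → c k (x + t) ≈ c k t) (sym l*P≡) (below (l * b) t k k≤j (subst (λ x → x + t < Z) l*P≡ lt))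
      where l*P≡ : l * P (suc j) ≡ l * b * P j
            l*P≡ = trans (cong (l *_) eq) (sym (*-assoc l b (P j)))
  ... | inj₂ refl = multiples l lt
    where
    once : ∀ t → P j + t < Z → c k (P j + t) ≈ c k t
    once t lt with at-lookup (drop (P j) xs) t (prefix-sound (drop (P j) xs) xs pre (at-drop (P j) xs rep) rep) t<
      where
      t< : t < length (drop (P j) xs)
      t< = subst (t <_) (trans (cong (_∸ P j) len≡) (sym (length-drop (P j) xs)))
             (subst (_< Z ∸ P j) (m+n∸m≡n (P j) t) (∸-monoˡ-< lt (m≤m+n (P j) t)))
    ... | x , x≈₁ , x≈₂ = ≈-trans (≈-sym x≈₁) x≈₂
    multiples : ∀ l → l * P j + t < Z → c k (l * P j + t) ≈ c k t
    multiples zero    _  = ≈-refl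
    multiples (suc l) lt = ≈-trans (≈-reflexive (cong (c k) (+-assoc (P j) (l * P j) t)))
      (≈-trans (once (l * P j + t) (subst (_< Z) (+-assoc (P j) (l * P j) t) lt))
        (multiples l (≤-<-trans (+-monoˡ-≤ t (m≤n+m (l * P j) (P j))) lt)))

  table-power : ∀ s j cs → AllRepresent (suc j) cs → periodic P Z j cs ≡ true → PeriodicBelow j →
                PowerLevels s j (table P p' pw s j cs)
  table-power s j []       _          _  _     = tt
  table-power s j (r ∷ rs) (rep , reps) ok below with ∧-elim ok
  ... | len≡ , ok' with ∧-elim ok'
  ... | pre , ok'' =
    treeOf-power j 1100 (powersOf p' pw s r)
      (at-weaken (λ t (t<Z , w) → power-map (t<Z ,_) w) _ (at-resize _ length≡ (at-length _ (powersOf-power s (suc j) r rep)))) ,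
    below , table-power s (suc j) rs reps ok'' (periodic-step j below r rep (≡ᵇ-sound len≡) pre)
    where
    length≡ : length (powersOf p' pw s r) ≡ Z
    length≡ = trans (length-map _ r) (sym (≡ᵇ-sound len≡))

  tables-power : ∀ cs → AllRepresent 1 cs → periodic P Z 0 cs ≡ true → ∀ k r → p ≤ 7 * k + r → PowerTables r (tables P X p' pw cs r k)
  tables-power cs reps ok zero    r p≤ = p≤
  tables-power cs reps ok (suc k) r p≤ =
    (t r , t (1 + r) , t (2 + r) , t (3 + r) , t (4 + r) , t (5 + r) , t (6 + r)) ,
    (refl , refl , refl , refl , refl , refl , refl , refl) ,
    tables-power cs reps ok k (7 + r) (≤-trans p≤ (≤-reflexive (trans (cong (_+ r) (trans (*-suc 7 k) (+-comm 7 (7 * k)))) (+-assoc (7 * k) 7 r))))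
    where
    t : ∀ r → PowerLevels (p ∸ r) 0 (table P p' pw (p ∸ r) 0 cs)
    t r = table-power (p ∸ r) 0 cs reps ok tt

  module _ (d : ℕ) (W₀≈d : ∀ t → t < 3 → W 0 t ≈ d) where

    rootLevels-sum : ∀ j cs → AllRepresent (2 + j) cs → periodic P Z (suc j) cs ≡ true → SumLevels 1 j (rootLevels A P p' pw d j cs)
    rootLevels-sum j []       _            _  = tt
    rootLevels-sum j (r ∷ rs) (rep , reps) ok with ∧-elim {Z ≡ᵇ length r} ok
    ... | len≡ , ok' =
      (length ys , ys<X , treeOf-sum j 1100 ys (at-weaken (λ t → power-map wins) ys
          (mask-power A 0 xs (at-weaken (λ t (t< , w) → power-map (t< ,_) w) xs (at-take (len (2 + j)) _ (powersOf-power d (2 + j) r rep)))))) ,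
      rootLevels-sum (suc j) rs reps (proj₂ (∧-elim ok'))
      where
      xs ys : List ℕ
      xs = take (len (2 + j)) (powersOf p' pw d r)
      ys = mask A 0 xs
      wins : ∀ {t e} → A t ≡ true × (t < len (2 + j) × e ≈ d * c (2 + j) t) → Wins 1 (suc j) t e
      wins {t} (At , t< , e≈) ≈0 = goal (2 + j) t t< At
        (≈-trans (W-res d W₀≈d (suc j) t t<) (≈-trans (res-cong 1 (suc j) (λ _ _ → ≈-refl) (≈-sym e≈)) ≈0))
      ys<X : length ys < X
      ys<X = ≤-<-trans (≤-reflexive (trans (length-mask A 0 xs) (length-take (len (2 + j)) (powersOf p' pw d r))))
               (≤-<-trans (m⊓n≤n (len (2 + j)) _) (subst (_< X) (trans (≡ᵇ-sound len≡) (sym (length-map _ r))) Z<X))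

    digits-sound : ∀ {n q us} → 2 + n ≡ X ^ p → PowerTables 0 us → ∀ {ms cs} → SumLevels 1 0 ms → AllRepresent 1 cs →
                   periodic P Z 0 cs ≡ true → ∀ ss → digits (env n (X ^ p * q) us) P p' pw cs ms ss ≡ true →
                   ∀ {s} → s ≈ σ 1 → elem s ss ≡ true → G
    digits-sound {n} {q} {us} 2+n≡ w {ms} {cs} v reps per (s' ∷ ss) ok {s} s≈ s∈ with ∧-elim ok | ∨-elim s∈
    ... | ok' , _ | inj₁ eq = digit-sound n q us 2+n≡ w {f = 20} (node-sound n q us 2+n≡ w 20) {b = false} ms (table P p' pw s' 0 cs)
                              (subst (_≈ σ 1) (≡ᵇ-sound {s} {s'} eq) s≈) v (table-power s' 0 cs reps per tt) (λ ()) ok'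
    ... | _ , ok' | inj₂ s∈ss = digits-sound 2+n≡ w v reps per ss ok' s≈ s∈ss

    search-sound : ∀ reps cs → AllRepresent 1 cs → search A P X Z p' d reps pw cs ≡ true →
                   ∀ {s} → s ≈ σ 1 → elem s reps ≡ true → G
    search-sound reps (r ∷ rs) (rep , reps') ok s≈ s∈ with ∧-elim {periodic P Z 0 (r ∷ rs)} ok
    ... | per , ok' = digits-sound (m+[n∸m]≡n 2≤X^p) (tables-power (r ∷ rs) (rep , reps') per (suc (p' / 7)) 0 p≤)
                        (rootLevels-sum 0 rs reps' (proj₂ (∧-elim (proj₂ (∧-elim {Z ≡ᵇ length r} per))))) (rep , reps') per reps ok' s≈ s∈
      where
      instance
        X≢0 : NonZero X
        X≢0 = >-nonZero (≤-trans (s≤s z≤n) 2≤X)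
      2≤X^p : 2 ≤ X ^ p
      2≤X^p = ≤-trans 2≤X (≤-trans (≤-reflexive (sym (*-identityʳ X))) (^-monoʳ-≤ X {1} {p} (s≤s z≤n)))
      p≤ : p ≤ 7 * suc (p' / 7) + 0
      p≤ = begin
        suc p'                       ≡⟨ cong suc (m≡m%n+[m/n]*n p' 7) ⟩
        suc (p' % 7) + p' / 7 * 7    ≤⟨ +-monoˡ-≤ (p' / 7 * 7) (m%n<n p' 7) ⟩
        7 + p' / 7 * 7               ≡⟨ *-comm (suc (p' / 7)) 7 ⟩
        7 * suc (p' / 7)             ≡⟨ +-identityʳ _ ⟨
        7 * suc (p' / 7) + 0         ∎
        where open ≤-Reasoning

    rows-represent : ∀ f k m xs → Represents m xs → AllRepresent m (rows p' f k xs)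
    rows-represent f zero    m xs v = tt
    rows-represent f (suc k) m xs v = v , rows-represent f k (suc m) _ (nextRow-represents f 0 0 xs ≈-refl v)

-- From the finite search to all plays.

module Cleared (X : ℕ) (2≤X : 2 ≤ X) (Z : ℕ) (Z<X : Z < X) (p' : ℕ) (1≤p' : 1 ≤ p') (A : ℕ → Bool) (G : Set) where
  open Congruence p'
  open Windows p' A G
  open Rows p'
  open Play

  period-∣ : ∀ q bs j → ∃ λ b → period q bs (suc j) ≡ b * period q bs j
  period-∣ q bs j = nth 2 bs j , refl

  verify-sound : ∀ bs d reps → verify A X Z p' bs d reps ≡ true → (S : Play) → (∀ t → t < 3 → W S 0 t ≈ d) →
                 ∀ {s} → s ≈ W S 1 0 → elem s reps ≡ true → G
  verify-sound bs d reps ok S W₀≈d s≈ s∈ = search-sound d W₀≈d reps _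
    (rows-represent d W₀≈d Z 8 1 _ (nextRow-represents Z {c 0} 0 0 (replicate Z 1) ≈-refl (at-replicate Z (λ _ → ≈-refl)))) ok s≈ s∈
    where open Search X p' 2≤X 1≤p' Z Z<X (period p bs) (period-∣ p bs) A G S

  anyBelow-sound : ∀ f n → anyBelow f n ≡ true → ∃ λ i → f i ≡ true
  anyBelow-sound f (suc n) ok with f n in eq
  ... | true  = n , eq
  ... | false = anyBelow-sound f n ok

  allBelow-sound : ∀ f n → allBelow f n ≡ true → ∀ {i} → i < n → f i ≡ true
  allBelow-sound f (suc n) ok i<sn with ∧-elim {f n} ok | m<1+n⇒m<n∨m≡n i<sn
  ... | _  , ok' | inj₁ i<n  = allBelow-sound f n ok' i<n
  ... | ok' , _  | inj₂ refl = ok'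

  ≡ᵇ%-≈ : ∀ {x y} → (x % p ≡ᵇ y % p) ≡ true → x ≈ y
  ≡ᵇ%-≈ e = mk (≡ᵇ-sound e)

  isUnit-sound : ∀ u → isUnit p' u ≡ true → Unit u
  isUnit-sound u ok with anyBelow-sound _ p ok
  ... | v , ok' = v , ≡ᵇ%-≈ ok'

  c-1 : ∀ t → c 1 t ≡ t
  c-1 zero    = refl
  c-1 (suc t) = trans (cong (_+ 1) (c-1 t)) (+-comm t 1)

  W₁≈ : ∀ S d → (∀ t → t < 3 → W S 0 t ≈ d) → ∀ t → t < 7 → W S 1 t ≈ W S 1 0 + d * t
  W₁≈ S d W₀≈d t t<7 = ≈-trans (W-res d W₀≈d 0 t t<7) (≈-reflexive (trans (+-comm _ (W S 1 0)) (cong (λ x → W S 1 0 + d * x) (c-1 t))))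
    where open Expansion p' A G S using (W-res)

  module _ (A-sym : Symmetric) (A1 : A 1 ≡ true) where

    root-sound : ∀ bs d reps → verify A X Z p' bs d reps ≡ true → complete A p' d reps ≡ true →
                 (S : Play) → (∀ t → t < 3 → W S 0 t ≈ d) → G
    root-sound bs d reps ok com S W₀≈d with ∨-elim {hits A p' d (W S 1 0 % p)} (allBelow-sound _ p com (m%n<n (W S 1 0) p))
    ... | inj₁ hit with anyBelow-sound _ 7 hit
    ... | t , hit' with ∧-elim {t <ᵇ 7} hit'
    ... | t<7 , hit'' with ∧-elim {A t} hit''
    ... | At , zero' = goal S 1 t (<ᵇ⇒< t 7 (≡true⇒T t<7)) At
      (≈-trans (W₁≈ S d W₀≈d t (<ᵇ⇒< t 7 (≡true⇒T t<7))) (≈-trans (+-cong-≈ (≈-sym (%-≈ (W S 1 0))) ≈-refl) (≡ᵇ%-≈ zero')))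
    root-sound bs d reps ok com S W₀≈d | inj₂ orb with anyBelow-sound _ p orb
    ... | u , orb' with ∧-elim {_} {isUnit p' u} orb'
    ... | orb'' , unit with ∨-elim {_} orb''
    ... | inj₁ same with ∧-elim {(u * d) % p ≡ᵇ d % p} same
    ... | ud≈d , s∈ = verify-sound bs d reps ok (scale u (isUnit-sound u unit) S)
      (λ t t<3 → ≈-trans (*-cong-≈ (≈-refl {u}) (W₀≈d t t<3)) (≡ᵇ%-≈ ud≈d))
      (≈-trans (%-≈ (u * (W S 1 0 % p))) (*-cong-≈ (≈-refl {u}) (%-≈ (W S 1 0)))) s∈
    root-sound bs d reps ok com S W₀≈d | inj₂ orb | u , orb' | orb'' , unit | inj₂ opp
      with ∧-elim {(u * d + d) % p ≡ᵇ 0 % p} opp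
    ... | ud+d≈0 , s∈ = verify-sound bs d reps ok (scale u (isUnit-sound u unit) (reflect A-sym S))
      (λ t t<3 → +-cancelʳ-≈ (u * d) (begin
        u * (p' ^ 1 * W S 0 (3 ∸ suc t)) + u * d    ≈⟨ +-cong-≈ (*-cong-≈ (≈-refl {u}) (*-cong-≈ (≈-refl {p' ^ 1}) (W₀≈d (3 ∸ suc t) (∸-monoʳ-< (s≤s z≤n) t<3)))) (≈-refl {u * d}) ⟩
        u * (p' ^ 1 * d) + u * d                    ≡⟨ *-distribˡ-+ u (p' ^ 1 * d) d ⟨
        u * (p' ^ 1 * d + d)                        ≡⟨ cong (λ x → u * (x * d + d)) (*-identityʳ p') ⟩
        u * (p' * d + d)                            ≡⟨ cong (u *_) (+-comm (p' * d) d) ⟩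
        u * (p * d)                                 ≈⟨ *-cong-≈ (≈-refl {u}) (p*-≈0 d) ⟩
        u * 0                                       ≡⟨ *-zeroʳ u ⟩
        0                                           ≈⟨ ≡ᵇ%-≈ ud+d≈0 ⟨
        u * d + d                                   ≡⟨ +-comm (u * d) d ⟩
        d + u * d                                   ∎))
      (≈-trans (%-≈ (u * (W S 1 0 % p + d * 6))) (*-cong-≈ (≈-refl {u}) (begin
        W S 1 0 % p + d * 6                         ≈⟨ +-cong-≈ (%-≈ (W S 1 0)) (≈-refl {d * 6}) ⟩
        W S 1 0 + d * 6                             ≈⟨ W₁≈ S d W₀≈d 6 ≤-refl ⟨
        W S 1 6                                     ≡⟨ *-identityˡ _ ⟨
        1 * W S 1 6                                 ≈⟨ *-cong-≈ p'^2≈1 (≈-refl {W S 1 6}) ⟨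
        p' ^ 2 * W S 1 6                            ∎))) s∈
      where
      open ≈-Reasoning
      p'^2≈1 : p' ^ 2 ≈ 1
      p'^2≈1 = ≈-trans (≈-reflexive (cong (p' *_) (*-identityʳ p'))) (proj₂ p'-unit)

    roots-sound : ∀ bs roots → allRoots A X Z p' bs roots ≡ true → ∀ u S → Unit u →
                  reachable p' (u * W S 0 0) roots ≡ true → (∀ t → t < 3 → W S 0 t ≈ W S 0 0) → G
    roots-sound bs ((d , reps) ∷ roots) ok u S unit reach const with ∧-elim ok | ∨-elim {(u * W S 0 0) % p ≡ᵇ d % p} reach
    ... | ok₁ , _ | inj₁ here with ∧-elim ok₁
    ... | ver , com = root-sound bs d reps ver com (scale u unit S)
      (λ t t<3 → ≈-trans (*-cong-≈ (≈-refl {u}) (const t t<3)) (≡ᵇ%-≈ here))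
    roots-sound bs (_ ∷ roots) ok u S unit reach const | _ , ok₂ | inj₂ there = roots-sound bs roots ok₂ u S unit there const

    cleared : ∀ bs roots → clears A X Z p' bs roots ≡ true → (S : Play) → (∀ t → t < 3 → W S 0 t ≈ W S 0 0) → G
    cleared bs roots ok S const with ∧-elim ok
    ... | starts , ok' with ∨-elim {W S 0 0 % p ≡ᵇ 0} (allBelow-sound _ p starts (m%n<n (W S 0 0) p))
    -- If σ₀ ≡ 0, window 0 consists of zeros, and its middle position counts by `A1`.
    ... | inj₁ zero' = goal S 0 1 (s≤s (s≤s z≤n)) A1 (≈-trans (const 1 (s≤s (s≤s z≤n))) (≈-trans (≈-sym (%-≈ (W S 0 0))) (≈-reflexive (≡ᵇ-sound zero'))))
    ... | inj₂ some with anyBelow-sound _ p some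
    ... | u , some' with ∧-elim {_} {isUnit p' u} some'
    ... | reach , unit = roots-sound bs roots ok' u S (isUnit-sound u unit)
      (trans (sym (reachable-% (u * (W S 0 0 % p)) (u * W S 0 0) roots (*-cong-≈ (≈-refl {u}) (%-≈ (W S 0 0))))) reach) const
      where
      reachable-% : ∀ x y roots → x ≈ y → reachable p' x roots ≡ reachable p' y roots
      reachable-% x y []                   x≈y = refl
      reachable-% x y ((d , _) ∷ roots) (mk e) = cong₂ (λ z b → (z ≡ᵇ d % p) ∨ b) e (reachable-% x y roots (mk e))

-- The windows of a and infinitely many zeros.

a-1 : a 1 ≡ 2
a-1 = trans (a-suc 0) (cong₂ _+_ a-0 a-0)

⌊double/2⌋ : ∀ n → ⌊ double n /2⌋ ≡ n
⌊double/2⌋ zero    = refl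
⌊double/2⌋ (suc n) = cong suc (⌊double/2⌋ n)

⌊double+/2⌋ : ∀ m n → ⌊ double m + n /2⌋ ≡ m + ⌊ n /2⌋
⌊double+/2⌋ zero    n = refl
⌊double+/2⌋ (suc m) n = cong suc (⌊double+/2⌋ m n)

a-suc-double : ∀ m → a (suc (suc (double m))) ≡ a (suc (double m)) + a (suc m)
a-suc-double m = trans (a-suc (suc (double m))) (cong (λ i → a (suc (double m)) + a (suc i)) (⌊double/2⌋ m))

a-suc-suc-double : ∀ m → a (suc (suc (suc (double m)))) ≡ a (suc (suc (double m))) + a (suc m)
a-suc-suc-double m = trans (a-suc (suc (suc (double m)))) (cong (λ i → a (suc (suc (double m))) + a (suc i))
  (trans (cong ⌊_/2⌋ (+-comm 1 (double m))) (trans (⌊double+/2⌋ m 1) (+-identityʳ m))))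

a-window : ∀ m t → a (suc (double m) + t) ≡ a (suc (double m)) + D (λ i → a (suc m + i)) t
a-window m zero    = trans (cong a (+-identityʳ _)) (sym (+-identityʳ _))
a-window m (suc t) = begin
  a (suc (double m) + suc t)                                    ≡⟨ cong a (+-suc (suc (double m)) t) ⟩
  a (suc (suc (double m + t)))                                  ≡⟨ a-suc (suc (double m + t)) ⟩
  a (suc (double m + t)) + a (suc ⌊ double m + t /2⌋)           ≡⟨ cong₂ (λ x i → x + a (suc i)) (a-window m t) (⌊double+/2⌋ m t) ⟩
  a (suc (double m)) + D w t + w ⌊ t /2⌋                        ≡⟨ +-assoc (a (suc (double m))) (D w t) _ ⟩
  a (suc (double m)) + D w (suc t)                              ∎
  where
  open ≡-Reasoning
  w : ℕ → ℕ
  w i = a (suc m + i)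

doubles : ℕ → ℕ → ℕ
doubles zero    n = n
doubles (suc j) n = double (doubles j n)

-- The window around 2^(j+1) n starts at 2^(j+1) (n-1) + 1.
start : ℕ → ℕ → ℕ
start j n = suc (doubles (suc j) (pred n))

n<start : ∀ j {n} → 2 ≤ n → n < start j n
n<start j {suc n} (s≤s 1≤n) = s≤s (go j)
  where
  n<double : ∀ {n} → 1 ≤ n → n < double n
  n<double {n} 1≤n = subst (n <_) (sym (double≡2* n)) (m<m+n n (≤-trans 1≤n (≤-reflexive (sym (+-identityʳ n)))))
  go : ∀ j → n < doubles (suc j) n
  go zero    = n<double 1≤n
  go (suc j) = <-trans (go j) (n<double (≤-trans 1≤n (<⇒≤ (go j))))

-- The bound `2 ≤ n` is carried along because it makes all windows of the play lie beyond `n`.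
Infinite : (ℕ → Set) → Set
Infinite P = ∀ N → ∃ λ n → N ≤ n × 2 ≤ n × P n

infinite-next : ∀ {P : ℕ → Set} n₀ → 2 ≤ n₀ → P n₀ → (∀ n → 2 ≤ n → P n → ∃ λ m → n < m × P m) → Infinite P
infinite-next n₀ 2≤n₀ Pn₀ next zero    = n₀ , z≤n , 2≤n₀ , Pn₀
infinite-next n₀ 2≤n₀ Pn₀ next (suc N) with infinite-next n₀ 2≤n₀ Pn₀ next N
... | n , N≤n , 2≤n , Pn with next n 2≤n Pn
... | m , n<m , Pm = m , ≤-trans (s≤s N≤n) n<m , ≤-trans 2≤n (<⇒≤ n<m) , Pm

module Walk (p' : ℕ) (A : ℕ → Bool) (G : Set) where
  open Congruence p'
  open Windows p' A G
  open Play

  play : ∀ n → (∀ j t → t < len j → A t ≡ true → p ∣ a (start j n + t) → G) → Play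
  play n goal' .W j t = a (start j n + t)
  play n goal' .step j t _ = ≈-reflexive (trans (a-window (doubles (suc j) (pred n)) t)
    (cong (λ i → a i + D (λ i → a (start j n + i)) t) (sym (+-identityʳ _))))
  play n goal' .goal j t t< At ≈0 = goal' j t t< At (≈0⇒∣ ≈0)

  -- Consecutive values among a(2n-1), a(2n), a(2n+1) differ by a(n), which is zero modulo p.
  play-const : ∀ n goal' → 2 ≤ n → p ∣ a n → ∀ t → t < 3 → W (play n goal') 0 t ≈ W (play n goal') 0 0
  play-const (suc n) goal' _ p∣a 0 _ = ≈-refl
  play-const (suc n) goal' _ p∣a 1 _ = begin
    a (suc (double n) + 1)          ≡⟨ cong a (+-comm (suc (double n)) 1) ⟩
    a (suc (suc (double n)))        ≡⟨ a-suc-double n ⟩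
    a (suc (double n)) + a (suc n)  ≈⟨ +-cong-≈ (≈-refl {a (suc (double n))}) (∣⇒≈0 p∣a) ⟩
    a (suc (double n)) + 0          ≡⟨ +-identityʳ _ ⟩
    a (suc (double n))              ≡⟨ cong a (+-identityʳ _) ⟨
    a (suc (double n) + 0)          ∎
    where open ≈-Reasoning
  play-const (suc n) goal' 2≤n p∣a 2 _ = begin
    a (suc (double n) + 2)                ≡⟨ cong a (+-comm (suc (double n)) 2) ⟩
    a (suc (suc (suc (double n))))        ≡⟨ a-suc-suc-double n ⟩
    a (suc (suc (double n))) + a (suc n)  ≈⟨ +-cong-≈ (≈-refl {a (suc (suc (double n)))}) (∣⇒≈0 p∣a) ⟩
    a (suc (suc (double n))) + 0          ≡⟨ +-identityʳ _ ⟩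
    a (suc (suc (double n)))              ≡⟨ cong a (+-comm 1 (suc (double n))) ⟩
    a (suc (double n) + 1)                ≈⟨ play-const (suc n) goal' 2≤n p∣a 1 (s≤s (s≤s z≤n)) ⟩
    a (suc (double n) + 0)                ∎
    where open ≈-Reasoning
  play-const (suc n) goal' _ p∣a (suc (suc (suc _))) (s≤s (s≤s (s≤s ())))

-- b₂(2(1+t)) = 2 + D (λ i → b₂(2(1+i))) t, so iterating from [ 2 ] gives a table.
values : ℕ → ℕ → ℕ → List ℕ
values p' f zero    = 2 ∷ []
values p' f (suc k) = nextRow p' f 2 (values p' f k)

-- The length test excludes the default value of `nth`.
zeroAt : (p' f k t : ℕ) → Bool
zeroAt p' f k t = (nth 1 (values p' f k) t % suc p' ≡ᵇ 0) ∧ (t <ᵇ length (values p' f k))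

zeroAt-sound : ∀ p' f k t → zeroAt p' f k t ≡ true → suc p' ∣ a (suc t)
zeroAt-sound p' f k t ok with ∧-elim {nth 1 (values p' f k) t % suc p' ≡ᵇ 0} ok
... | z , t< = ≈0⇒∣ (≈-trans (≈-sym (at-nth (values p' f k) t (represents f k) (<ᵇ⇒< t _ (≡true⇒T t<)))) (mk (≡ᵇ-sound z)))
  where
  open Congruence p'
  open Rows p'
  a-1+ : ∀ t → 2 + D (λ i → a (suc i)) t ≡ a (suc t)
  a-1+ t = sym (trans (a-window 0 t) (cong (_+ D (λ i → a (suc i)) t) a-1))
  represents : ∀ f k → At (λ t x → x ≈ a (suc t)) (values p' f k)
  represents f zero    = ≈-reflexive (sym a-1) , tt
  represents f (suc k) = at-weaken (λ t e → ≈-trans e (≈-reflexive (a-1+ t))) _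
    (nextRow-represents f 2 2 (values p' f k) ≈-refl (represents f k))
  at-nth : ∀ {R : ℕ → ℕ → Set} {d} xs t → At R xs → t < length xs → R t (nth d xs t)
  at-nth (x ∷ xs) zero    (r , rs) _        = r
  at-nth (x ∷ xs) (suc t) (r , rs) (s≤s t<) = at-nth xs t rs t<

anywhere : ℕ → Bool
anywhere _ = true

-- Every zero starts a play, and the search finds a larger zero in it.
infinite-zeros : ∀ X → 2 ≤ X → ∀ Z → Z < X → ∀ p' → 1 ≤ p' → ∀ bs roots → clears anywhere X Z p' bs roots ≡ true →
                 ∀ f k t → zeroAt p' f k (suc t) ≡ true → Infinite (λ n → suc p' ∣ a n)
infinite-zeros X 2≤X Z Z<X p' 1≤p' bs roots ok f k t z =
  infinite-next (2 + t) (s≤s (s≤s z≤n)) (zeroAt-sound p' f k (suc t) z) next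
  where
  next : ∀ n → 2 ≤ n → suc p' ∣ a n → ∃ λ m → n < m × suc p' ∣ a m
  next n 2≤n p∣a = cleared (λ _ _ _ _ → refl) refl bs roots ok (play n goal') (play-const n goal' 2≤n p∣a)
    where
    G : Set
    G = ∃ λ m → n < m × suc p' ∣ a m
    open Walk p' anywhere G
    open Cleared X 2≤X Z Z<X p' 1≤p' anywhere G
    goal' : ∀ j t → t < len j → anywhere t ≡ true → suc p' ∣ a (start j n + t) → G
    goal' j t _ _ d = start j n + t , <-≤-trans (n<start j 2≤n) (m≤m+n _ t) , d

-- The values of a modulo 4.

a-even : ∀ n → 2 ∣ a (suc n)
a-even = <-rec _ step
  where
  step : ∀ n → (∀ {i} → i < n → 2 ∣ a (suc i)) → 2 ∣ a (suc n)
  step zero    ih = divides 1 a-1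
  step (suc n) ih = subst (2 ∣_) (sym (a-suc (suc n))) (∣m∣n⇒∣m+n (ih ≤-refl) (ih (s≤s (⌊n/2⌋≤n n))))

open Congruence 3 using (_≈_; mk; ≈-refl; ≈-sym; ≈-trans; ≈-reflexive; +-cong-≈; *-cong-≈; ∣⇒≈0; ≈0⇒∣)

-- From one odd argument to the next, a grows by 2 a(m+1), a multiple of 4 by `a-even`.
a-odd-mod4 : ∀ m → a (suc (double m)) ≈ 2
a-odd-mod4 zero    = ≈-reflexive a-1
a-odd-mod4 (suc m) = ≈-trans (≈-reflexive (trans (a-suc-suc-double m) (trans (cong (_+ a (suc m)) (a-suc-double m)) (+-assoc (a (suc (double m))) _ _))))
  (+-cong-≈ (a-odd-mod4 m) (∣⇒≈0 (subst (4 ∣_) (cong (a (suc m) +_) (+-identityʳ (a (suc m)))) (*-monoʳ-∣ 2 (a-even m)))))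

a-even-mod4 : ∀ m → a (double (suc m)) ≈ 2 + a (suc m)
a-even-mod4 m = ≈-trans (≈-reflexive (a-suc-double m)) (+-cong-≈ (a-odd-mod4 m) ≈-refl)

2∣⇒mod4 : ∀ {x} → 2 ∣ x → 4 ∣ x ⊎ x ≈ 2
2∣⇒mod4 (divides q refl) with even⊎odd q
... | inj₁ e = inj₁ (divides ⌊ q /2⌋ (trans (cong (_* 2) (trans e (double≡2* ⌊ q /2⌋))) (eq ⌊ q /2⌋)))
  where eq : ∀ r → 2 * r * 2 ≡ r * 4
        eq = solve 1 (λ r → con 2 :* r :* con 2 := r :* con 4) refl where open +-*-Solver
... | inj₂ o = inj₂ (mk (trans (cong (_% 4) (trans (cong (_* 2) (trans o (cong suc (double≡2* ⌊ q /2⌋)))) (eq ⌊ q /2⌋))) ([m+kn]%n≡m%n 2 ⌊ q /2⌋ 4)))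
  where eq : ∀ r → (1 + 2 * r) * 2 ≡ 2 + r * 4
        eq = solve 1 (λ r → (con 1 :+ con 2 :* r) :* con 2 := con 2 :+ r :* con 4) refl where open +-*-Solver

4∣a[2n] : ∀ n → a (suc n) ≈ 2 → 4 ∣ a (double (suc n))
4∣a[2n] n e = ≈0⇒∣ (≈-trans (a-even-mod4 n) (≈-trans (+-cong-≈ (≈-refl {2}) e) (mk refl)))

4∣a[8n] : ∀ n → a (suc n) ≈ 2 → 4 ∣ a (double (double (double (suc n))))
4∣a[8n] n e = ≈0⇒∣ (begin
  a (double (double (double (suc n))))      ≈⟨ a-even-mod4 _ ⟩
  2 + a (double (double (suc n)))           ≈⟨ +-cong-≈ (≈-refl {2}) (a-even-mod4 _) ⟩
  2 + (2 + a (double (suc n)))              ≈⟨ +-cong-≈ (≈-refl {2}) (+-cong-≈ (≈-refl {2}) (∣⇒≈0 (4∣a[2n] n e))) ⟩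
  4                                         ≈⟨ mk refl ⟩
  0                                         ∎)
  where open Congruence.≈-Reasoning 3

4∣a[4k+2] : ∀ {i} k → i ≡ 2 + 4 * k → 4 ∣ a i
4∣a[4k+2] {i} k i≡ = subst (λ i → 4 ∣ a i) (sym eq) (4∣a[2n] (double k) (a-odd-mod4 k))
  where eq : i ≡ double (suc (double k))
        eq = trans i≡ (cong (λ x → suc (suc x)) (trans (*-assoc 2 2 k) (trans (cong (2 *_) (sym (double≡2* k))) (sym (double≡2* (double k))))))

4∣a[16k+8] : ∀ {i} k → i ≡ 8 + 16 * k → 4 ∣ a i
4∣a[16k+8] {i} k i≡ = subst (λ i → 4 ∣ a i) (sym eq) (4∣a[8n] (double k) (a-odd-mod4 k))
  where open +-*-Solver
        m : ℕ
        m = suc (double k)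
        eq : i ≡ double (double (double (suc (double k))))
        eq = trans i≡ (trans (solve 1 (λ k → con 8 :+ con 16 :* k := con 2 :* (con 2 :* (con 2 :* (con 1 :+ con 2 :* k)))) refl k)
          (sym (trans (double≡2* (double (double m))) (cong (2 *_) (trans (double≡2* (double m)) (cong (2 *_) (trans (double≡2* m) (cong (λ x → 2 * suc x) (double≡2* k)))))))))

-- Window j starts at 1 modulo 2^(j+1). Residues 1, 5, 9, 13 lead to arguments 2 modulo 4 once j ≥
-- 1, and 7 to arguments 8 modulo 16 once j ≥ 3. In windows 0 and 2, positions 1 and 7 are the
-- arguments 2n and 8n.
goodResidues : List ℕ
goodResidues = 1 ∷ 5 ∷ 9 ∷ 13 ∷ 7 ∷ []

-- If a n ≡ 2 (mod 4), then 4 divides a at these positions of every window around 2^(j+1) n.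
allowed : ℕ → Bool
allowed t = elem (t % 16) goodResidues

allowed-residue : ∀ t → allowed t ≡ true → (∃ λ i → i ≤ 3 × t % 16 ≡ 1 + 4 * i) ⊎ t % 16 ≡ 7
allowed-residue t ok with ∨-elim {t % 16 ≡ᵇ 1} ok
... | inj₁ e = inj₁ (0 , z≤n , ≡ᵇ-sound e)
... | inj₂ ok with ∨-elim {t % 16 ≡ᵇ 5} ok
... | inj₁ e = inj₁ (1 , s≤s z≤n , ≡ᵇ-sound e)
... | inj₂ ok with ∨-elim {t % 16 ≡ᵇ 9} ok
... | inj₁ e = inj₁ (2 , s≤s (s≤s z≤n) , ≡ᵇ-sound e)
... | inj₂ ok with ∨-elim {t % 16 ≡ᵇ 13} ok
... | inj₁ e = inj₁ (3 , s≤s (s≤s (s≤s z≤n)) , ≡ᵇ-sound e)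
... | inj₂ ok with ∨-elim {t % 16 ≡ᵇ 7} ok
... | inj₁ e = inj₂ (≡ᵇ-sound e)

doubles-4 : ∀ j n → doubles (2 + j) n ≡ 4 * doubles j n
doubles-4 j n = trans (double≡2* _) (trans (cong (2 *_) (double≡2* (doubles j n))) (sym (*-assoc 2 2 (doubles j n))))

allowed-4∣ : ∀ n → a (suc n) ≈ 2 → ∀ j t → t < len j → allowed t ≡ true → 4 ∣ a (start j (suc n) + t)
allowed-4∣ n e 0 1 _ _ = subst (λ i → 4 ∣ a i) (+-comm 1 (suc (double n))) (4∣a[2n] n e)
allowed-4∣ n e 0 0 _ ()
allowed-4∣ n e 0 2 _ ()
allowed-4∣ n e 0 (suc (suc (suc _))) (s≤s (s≤s (s≤s ())))
allowed-4∣ n e (suc j) t t< ok with allowed-residue t ok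
... | inj₁ (i , _ , t%16≡) = 4∣a[4k+2] (doubles j n + (i + 4 * (t / 16))) (begin
  suc (doubles (2 + j) n) + t                            ≡⟨ cong₂ (λ x y → suc x + y) (doubles-4 j n) (trans (m≡m%n+[m/n]*n t 16) (cong (_+ t / 16 * 16) t%16≡)) ⟩
  suc (4 * doubles j n) + (1 + 4 * i + t / 16 * 16)      ≡⟨ arrange (doubles j n) i (t / 16) ⟩
  2 + 4 * (doubles j n + (i + 4 * (t / 16)))             ∎)
  where
  open ≡-Reasoning
  arrange : ∀ x i q → suc (4 * x) + (1 + 4 * i + q * 16) ≡ 2 + 4 * (x + (i + 4 * q))
  arrange = solve 3 (λ x i q → con 1 :+ con 4 :* x :+ (con 1 :+ con 4 :* i :+ q :* con 16) := con 2 :+ con 4 :* (x :+ (i :+ con 4 :* q))) refl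
    where open +-*-Solver
allowed-4∣ n e (suc zero) t t< ok | inj₂ t%16≡7 = ⊥-elim (<-irrefl refl (<-≤-trans t< (subst (_≤ t) t%16≡7 (m%n≤m t 16))))
allowed-4∣ n e (suc (suc zero)) t t< ok | inj₂ t%16≡7 =
  subst (λ i → 4 ∣ a i) (trans (+-comm 7 (suc (doubles 3 n))) (cong (suc (doubles 3 n) +_) (trans (sym t%16≡7) (m<n⇒m%n≡m (≤-trans t< (n≤1+n 15)))))) (4∣a[8n] n e)
allowed-4∣ n e (suc (suc (suc j))) t t< ok | inj₂ t%16≡7 = 4∣a[16k+8] (doubles j n + t / 16) (begin
  suc (doubles (4 + j) n) + t                            ≡⟨ cong₂ (λ x y → suc x + y) (trans (doubles-4 (2 + j) n) (cong (4 *_) (doubles-4 j n))) (trans (m≡m%n+[m/n]*n t 16) (cong (_+ t / 16 * 16) t%16≡7)) ⟩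
  suc (4 * (4 * doubles j n)) + (7 + t / 16 * 16)        ≡⟨ arrange (doubles j n) (t / 16) ⟩
  8 + 16 * (doubles j n + t / 16)                        ∎)
  where
  open ≡-Reasoning
  arrange : ∀ x q → suc (4 * (4 * x)) + (7 + q * 16) ≡ 8 + 16 * (x + q)
  arrange = solve 2 (λ x q → con 1 :+ con 4 :* (con 4 :* x) :+ (con 7 :+ q :* con 16) := con 8 :+ con 16 :* (x :+ q)) refl
    where open +-*-Solver

len-mod16 : ∀ j → ∃ λ y → len (2 + j) ≡ 15 + 16 * y
len-mod16 zero    = 0 , refl
len-mod16 (suc j) with len-mod16 j
... | y , e = 1 + 2 * y , trans (cong (λ x → suc (2 * x)) e)
  (solve 1 (λ y → con 1 :+ con 2 :* (con 15 :+ con 16 :* y) := con 15 :+ con 16 :* (con 1 :+ con 2 :* y)) refl y)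
  where open +-*-Solver

-- The residues are symmetric about 7; as window lengths are 15 modulo 16 from window 2 on,
-- reflection acts on residues by r ↦ 14 - r.
allowed-mirror : ∀ r → r ≤ 14 → allowed r ≡ true → allowed (14 ∸ r) ≡ true
allowed-mirror 1  _ _ = refl
allowed-mirror 5  _ _ = refl
allowed-mirror 7  _ _ = refl
allowed-mirror 9  _ _ = refl
allowed-mirror 13 _ _ = refl
allowed-mirror 0  _ ()
allowed-mirror 2  _ ()
allowed-mirror 3  _ ()
allowed-mirror 4  _ ()
allowed-mirror 6  _ ()
allowed-mirror 8  _ ()
allowed-mirror 10 _ ()
allowed-mirror 11 _ ()
allowed-mirror 12 _ ()
allowed-mirror 14 _ ()
allowed-mirror (suc (suc (suc (suc (suc (suc (suc (suc (suc (suc (suc (suc (suc (suc (suc r))))))))))))))) r≤14 _ =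
  ⊥-elim (m+1+n≰m 14 (subst (_≤ 14) (+-comm (suc r) 14) (subst (_≤ 14) (+-comm 14 (suc r)) r≤14)))

allowed-symmetric : ∀ j t → t < len j → allowed t ≡ true → allowed (len j ∸ suc t) ≡ true
allowed-symmetric 0 1 _ _ = refl
allowed-symmetric 0 0 _ ()
allowed-symmetric 0 2 _ ()
allowed-symmetric 0 (suc (suc (suc _))) (s≤s (s≤s (s≤s ())))
allowed-symmetric 1 1 _ _ = refl
allowed-symmetric 1 5 _ _ = refl
allowed-symmetric 1 0 _ ()
allowed-symmetric 1 2 _ ()
allowed-symmetric 1 3 _ ()
allowed-symmetric 1 4 _ ()
allowed-symmetric 1 6 _ ()
allowed-symmetric 1 (suc (suc (suc (suc (suc (suc (suc _))))))) (s≤s (s≤s (s≤s (s≤s (s≤s (s≤s (s≤s ())))))))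
allowed-symmetric (suc (suc j)) t t< ok with len-mod16 j
... | y , len≡ = trans (cong allowed mirrored) (trans (cong (λ r → elem r goodResidues) ([m+kn]%n≡m%n (14 ∸ r) o 16)) (allowed-mirror r r≤14 ok'))
  where
  r q o : ℕ
  r = t % 16
  q = t / 16
  t≡ : t ≡ r + q * 16
  t≡ = m≡m%n+[m/n]*n t 16
  ok' : allowed r ≡ true
  ok' = trans (cong (λ r → elem r goodResidues) (m%n%n≡m%n t 16)) ok
  r≤14 : r ≤ 14
  r≤14 with m≤n⇒m<n∨m≡n (s≤s⁻¹ (m%n<n t 16))
  ... | inj₁ r<15 = s≤s⁻¹ r<15
  ... | inj₂ r≡15 with subst (λ r → elem r goodResidues ≡ true) r≡15 ok
  ... | ()
  q≤y : q ≤ y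
  q≤y = s≤s⁻¹ (*-cancelˡ-< 16 q (suc y) (begin-strict
    16 * q           ≡⟨ *-comm 16 q ⟩
    q * 16           ≤⟨ m≤n+m (q * 16) r ⟩
    r + q * 16       ≡⟨ t≡ ⟨
    t                <⟨ subst (t <_) len≡ t< ⟩
    15 + 16 * y      ≤⟨ n≤1+n _ ⟩
    16 + 16 * y      ≡⟨ *-suc 16 y ⟨
    16 * suc y       ∎))
    where open ≤-Reasoning
  o = y ∸ q
  mirrored : len (2 + j) ∸ suc t ≡ 14 ∸ r + o * 16
  mirrored = begin
    len (2 + j) ∸ suc t                                     ≡⟨ cong₂ (λ x z → x ∸ suc z) len≡ t≡ ⟩
    15 + 16 * y ∸ (1 + (r + q * 16))                        ≡⟨ cong (λ y → 14 + 16 * y ∸ (r + q * 16)) (sym (m∸n+n≡m q≤y)) ⟩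
    14 + 16 * (o + q) ∸ (r + q * 16)                        ≡⟨ cong (λ s → s + 16 * (o + q) ∸ (r + q * 16)) (sym (m∸n+n≡m r≤14)) ⟩
    14 ∸ r + r + 16 * (o + q) ∸ (r + q * 16)                ≡⟨ cong (_∸ (r + q * 16)) (arrange (14 ∸ r) r o q) ⟩
    14 ∸ r + o * 16 + (r + q * 16) ∸ (r + q * 16)           ≡⟨ m+n∸n≡m (14 ∸ r + o * 16) (r + q * 16) ⟩
    14 ∸ r + o * 16                                         ∎
    where
    open ≡-Reasoning
    arrange : ∀ a b c d → a + b + 16 * (c + d) ≡ a + c * 16 + (b + d * 16)
    arrange = solve 4 (λ a b c d → a :+ b :+ con 16 :* (c :+ d) := a :+ c :* con 16 :+ (b :+ d :* con 16)) refl
      where open +-*-Solver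

-- A zero n modulo k has a(n) ≡ 0 or 2 modulo 4. In the second case one play, restricted to the
-- allowed positions, leads to a zero modulo both 4 and k.
infinite-zeros-4 : ∀ X → 2 ≤ X → ∀ Z → Z < X → ∀ p' → 1 ≤ p' → ∀ bs roots → clears allowed X Z p' bs roots ≡ true →
                   Infinite (λ n → suc p' ∣ a n) → Infinite (λ n → suc p' ∣ a n × 4 ∣ a n)
infinite-zeros-4 X 2≤X Z Z<X p' 1≤p' bs roots ok zeros N with zeros N
... | suc n , N≤n , 2≤n , p∣a with 2∣⇒mod4 (a-even n)
... | inj₁ 4∣a = suc n , N≤n , 2≤n , p∣a , 4∣a
... | inj₂ a≈2 with cleared allowed-symmetric refl bs roots ok (play (suc n) goal') (play-const (suc n) goal' 2≤n p∣a)
  where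
  G : Set
  G = ∃ λ m → suc n < m × suc p' ∣ a m × 4 ∣ a m
  open Walk p' allowed G
  open Cleared X 2≤X Z Z<X p' 1≤p' allowed G
  goal' : ∀ j t → t < len j → allowed t ≡ true → suc p' ∣ a (start j (suc n) + t) → G
  goal' j t t< ok d = start j (suc n) + t , <-≤-trans (n<start j 2≤n) (m≤m+n _ t) , d , allowed-4∣ n a≈2 j t t< ok
... | m , n<m , p∣am , 4∣am = m , ≤-trans N≤n (<⇒≤ n<m) , ≤-trans 2≤n (<⇒≤ n<m) , p∣am , 4∣am

-- The verified searches.

-- The final arguments 200 7 t refl verify the initial zero a(t + 2), in a table of the first 200 values.
zeros-3 : Infinite (λ n → 3 ∣ a n)
zeros-3 = infinite-zeros 1024 (s≤s (s≤s z≤n)) 255 (<ᵇ⇒< _ _ tt) 2 (s≤s z≤n) (2 ∷ 6 ∷ [])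
  ((1 , []) ∷
   [])
  refl 200 7 1 refl

zeros-5 : Infinite (λ n → 5 ∣ a n)
-- The base 1024 exceeds the number of positions, 255 or 1023. In the list of quotients, 6, 10 and
-- 14 stand for the steps to the periods of c₃, c₅ and c₇.
zeros-5 = infinite-zeros 1024 (s≤s (s≤s z≤n)) 255 (<ᵇ⇒< _ _ tt) 4 (s≤s z≤n) (2 ∷ 2 ∷ 2 ∷ 10 ∷ [])
  -- Seven consecutive entries of window 1 meet every residue modulo 5, so no σ₁ remains.
  ((1 , []) ∷
   [])
  refl 200 7 2 refl

zeros-7 : Infinite (λ n → 7 ∣ a n)
zeros-7 = infinite-zeros 1024 (s≤s (s≤s z≤n)) 255 (<ᵇ⇒< _ _ tt) 6 (s≤s z≤n) (2 ∷ 2 ∷ 2 ∷ 2 ∷ 2 ∷ 14 ∷ [])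
  ((1 , []) ∷
   [])
  refl 200 7 3 refl

zeros-9 : Infinite (λ n → 9 ∣ a n)
zeros-9 = infinite-zeros 1024 (s≤s (s≤s z≤n)) 255 (<ᵇ⇒< _ _ tt) 8 (s≤s z≤n) (2 ∷ 6 ∷ [])
  -- Only σ₁ = 1 and 2 avoid a zero in window 1, and reflection exchanges them.
  ((1 , 1 ∷ []) ∷
   (3 , 1 ∷ []) ∷
   [])
  refl 200 7 6 refl

zeros-11 : Infinite (λ n → 11 ∣ a n)
zeros-11 = infinite-zeros 1024 (s≤s (s≤s z≤n)) 255 (<ᵇ⇒< _ _ tt) 10 (s≤s z≤n) []
  ((1 , 1 ∷ 2 ∷ []) ∷
   [])
  refl 200 7 17 refl

zeros-13 : Infinite (λ n → 13 ∣ a n)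
zeros-13 = infinite-zeros 1024 (s≤s (s≤s z≤n)) 255 (<ᵇ⇒< _ _ tt) 12 (s≤s z≤n) []
  ((1 , 1 ∷ 2 ∷ 3 ∷ []) ∷
   [])
  refl 200 7 5 refl

zeros-15 : Infinite (λ n → 15 ∣ a n)
zeros-15 = infinite-zeros 1024 (s≤s (s≤s z≤n)) 255 (<ᵇ⇒< _ _ tt) 14 (s≤s z≤n) (2 ∷ 6 ∷ 2 ∷ 10 ∷ [])
  ((1 , 1 ∷ 2 ∷ 3 ∷ 4 ∷ []) ∷
   (3 , 1 ∷ 2 ∷ 4 ∷ []) ∷
   (5 , 1 ∷ 3 ∷ []) ∷
   [])
  refl 200 7 8 refl

zeros-17 : Infinite (λ n → 17 ∣ a n)
zeros-17 = infinite-zeros 1024 (s≤s (s≤s z≤n)) 255 (<ᵇ⇒< _ _ tt) 16 (s≤s z≤n) []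
  ((1 , 1 ∷ 2 ∷ 3 ∷ 4 ∷ 5 ∷ []) ∷
   [])
  refl 200 7 15 refl

zeros-19 : Infinite (λ n → 19 ∣ a n)
zeros-19 = infinite-zeros 1024 (s≤s (s≤s z≤n)) 255 (<ᵇ⇒< _ _ tt) 18 (s≤s z≤n) []
  ((1 , 1 ∷ 2 ∷ 3 ∷ 4 ∷ 5 ∷ 6 ∷ []) ∷
   [])
  refl 200 7 11 refl

zeros-21 : Infinite (λ n → 21 ∣ a n)
zeros-21 = infinite-zeros 1024 (s≤s (s≤s z≤n)) 1023 (<ᵇ⇒< _ _ tt) 20 (s≤s z≤n) (2 ∷ 6 ∷ [])
  ((1 , 1 ∷ 2 ∷ 3 ∷ 4 ∷ 5 ∷ 6 ∷ 7 ∷ []) ∷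
   (3 , 1 ∷ 4 ∷ 5 ∷ 7 ∷ []) ∷
   (7 , 1 ∷ 3 ∷ []) ∷
   [])
  refl 200 7 32 refl

zeros-23 : Infinite (λ n → 23 ∣ a n)
zeros-23 = infinite-zeros 1024 (s≤s (s≤s z≤n)) 1023 (<ᵇ⇒< _ _ tt) 22 (s≤s z≤n) []
  ((1 , 1 ∷ 2 ∷ 3 ∷ 4 ∷ 5 ∷ 6 ∷ 7 ∷ 8 ∷ []) ∷
   [])
  refl 200 7 7 refl

zeros-25 : Infinite (λ n → 25 ∣ a n)
zeros-25 = infinite-zeros 1024 (s≤s (s≤s z≤n)) 1023 (<ᵇ⇒< _ _ tt) 24 (s≤s z≤n) (2 ∷ 2 ∷ 2 ∷ 10 ∷ [])
  ((1 , 1 ∷ 2 ∷ 3 ∷ 4 ∷ 5 ∷ 6 ∷ 7 ∷ 8 ∷ 9 ∷ []) ∷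
   (5 , 1 ∷ 2 ∷ []) ∷
   [])
  refl 200 7 19 refl

zeros-27 : Infinite (λ n → 27 ∣ a n)
zeros-27 = infinite-zeros 1024 (s≤s (s≤s z≤n)) 1023 (<ᵇ⇒< _ _ tt) 26 (s≤s z≤n) (2 ∷ 6 ∷ [])
  ((1 , 1 ∷ 2 ∷ 3 ∷ 4 ∷ 5 ∷ 6 ∷ 7 ∷ 8 ∷ 9 ∷ 10 ∷ []) ∷
   (3 , 1 ∷ 2 ∷ 3 ∷ 4 ∷ []) ∷
   (9 , 1 ∷ 3 ∷ []) ∷
   [])
  refl 200 7 32 refl

zeros-29 : Infinite (λ n → 29 ∣ a n)
zeros-29 = infinite-zeros 1024 (s≤s (s≤s z≤n)) 1023 (<ᵇ⇒< _ _ tt) 28 (s≤s z≤n) []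
  ((1 , 1 ∷ 2 ∷ 3 ∷ 4 ∷ 5 ∷ 6 ∷ 7 ∷ 8 ∷ 9 ∷ 10 ∷ 11 ∷ []) ∷
   [])
  refl 200 7 31 refl

zeros-31 : Infinite (λ n → 31 ∣ a n)
zeros-31 = infinite-zeros 1024 (s≤s (s≤s z≤n)) 1023 (<ᵇ⇒< _ _ tt) 30 (s≤s z≤n) []
  ((1 , 1 ∷ 2 ∷ 3 ∷ 4 ∷ 5 ∷ 6 ∷ 7 ∷ 8 ∷ 9 ∷ 10 ∷ 11 ∷ 12 ∷ []) ∷
   [])
  refl 200 7 34 refl

zeros-33 : Infinite (λ n → 33 ∣ a n)
zeros-33 = infinite-zeros 1024 (s≤s (s≤s z≤n)) 1023 (<ᵇ⇒< _ _ tt) 32 (s≤s z≤n) (2 ∷ 6 ∷ [])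
  ((1 , 1 ∷ 2 ∷ 3 ∷ 4 ∷ 5 ∷ 6 ∷ 7 ∷ 8 ∷ 9 ∷ 10 ∷ 11 ∷ 12 ∷ 13 ∷ []) ∷
   (3 , 1 ∷ 2 ∷ 3 ∷ 4 ∷ 5 ∷ 6 ∷ 7 ∷ 17 ∷ []) ∷
   (11 , 1 ∷ 3 ∷ []) ∷
   [])
  refl 200 7 17 refl

zeros-35 : Infinite (λ n → 35 ∣ a n)
zeros-35 = infinite-zeros 1024 (s≤s (s≤s z≤n)) 1023 (<ᵇ⇒< _ _ tt) 34 (s≤s z≤n) (2 ∷ 2 ∷ 2 ∷ 10 ∷ [])
  ((1 , 1 ∷ 2 ∷ 3 ∷ 4 ∷ 5 ∷ 6 ∷ 7 ∷ 8 ∷ 9 ∷ 10 ∷ 11 ∷ 12 ∷ 13 ∷ 14 ∷ []) ∷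
   (5 , 1 ∷ 2 ∷ 6 ∷ 7 ∷ []) ∷
   (7 , 1 ∷ 3 ∷ 4 ∷ []) ∷
   [])
  refl 200 7 12 refl

zeros-37 : Infinite (λ n → 37 ∣ a n)
zeros-37 = infinite-zeros 1024 (s≤s (s≤s z≤n)) 1023 (<ᵇ⇒< _ _ tt) 36 (s≤s z≤n) []
  ((1 , 1 ∷ 2 ∷ 3 ∷ 4 ∷ 5 ∷ 6 ∷ 7 ∷ 8 ∷ 9 ∷ 10 ∷ 11 ∷ 12 ∷ 13 ∷ 14 ∷ 15 ∷ []) ∷
   [])
  refl 200 7 9 refl

zeros-39 : Infinite (λ n → 39 ∣ a n)
zeros-39 = infinite-zeros 1024 (s≤s (s≤s z≤n)) 1023 (<ᵇ⇒< _ _ tt) 38 (s≤s z≤n) (2 ∷ 6 ∷ [])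
  ((1 , 1 ∷ 2 ∷ 3 ∷ 4 ∷ 5 ∷ 6 ∷ 7 ∷ 8 ∷ 9 ∷ 10 ∷ 11 ∷ 12 ∷ 13 ∷ 14 ∷ 15 ∷ 16 ∷ []) ∷
   (3 , 1 ∷ 2 ∷ 3 ∷ 4 ∷ 5 ∷ 6 ∷ 8 ∷ 9 ∷ 10 ∷ 22 ∷ []) ∷
   (13 , 1 ∷ 3 ∷ []) ∷
   [])
  refl 200 7 18 refl

zeros-41 : Infinite (λ n → 41 ∣ a n)
zeros-41 = infinite-zeros 1024 (s≤s (s≤s z≤n)) 1023 (<ᵇ⇒< _ _ tt) 40 (s≤s z≤n) []
  ((1 , 1 ∷ 2 ∷ 3 ∷ 4 ∷ 5 ∷ 6 ∷ 7 ∷ 8 ∷ 9 ∷ 10 ∷ 11 ∷ 12 ∷ 13 ∷ 14 ∷ 15 ∷ 16 ∷ 17 ∷ []) ∷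
   [])
  refl 200 7 89 refl

zeros-4-3 : Infinite (λ n → 3 ∣ a n × 4 ∣ a n)
zeros-4-3 = infinite-zeros-4 1024 (s≤s (s≤s z≤n)) 255 (<ᵇ⇒< _ _ tt) 2 (s≤s z≤n) (2 ∷ 6 ∷ [])
  -- In window 1 only positions 1 and 5 count, which leaves σ₁ = 0 open.
  ((1 , 0 ∷ []) ∷
   [])
  refl zeros-3

zeros-4-5 : Infinite (λ n → 5 ∣ a n × 4 ∣ a n)
zeros-4-5 = infinite-zeros-4 1024 (s≤s (s≤s z≤n)) 255 (<ᵇ⇒< _ _ tt) 4 (s≤s z≤n) (2 ∷ 2 ∷ 2 ∷ 10 ∷ [])
  ((1 , 1 ∷ 2 ∷ []) ∷
   [])
  refl zeros-5

zeros-4-7 : Infinite (λ n → 7 ∣ a n × 4 ∣ a n)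
zeros-4-7 = infinite-zeros-4 1024 (s≤s (s≤s z≤n)) 255 (<ᵇ⇒< _ _ tt) 6 (s≤s z≤n) (2 ∷ 2 ∷ 2 ∷ 2 ∷ 2 ∷ 14 ∷ [])
  ((1 , 0 ∷ 3 ∷ 4 ∷ []) ∷
   [])
  refl zeros-7

zeros-4-9 : Infinite (λ n → 9 ∣ a n × 4 ∣ a n)
zeros-4-9 = infinite-zeros-4 1024 (s≤s (s≤s z≤n)) 1023 (<ᵇ⇒< _ _ tt) 8 (s≤s z≤n) (2 ∷ 6 ∷ [])
  ((1 , 0 ∷ 1 ∷ 5 ∷ 6 ∷ []) ∷
   (3 , 0 ∷ 1 ∷ []) ∷
   [])
  refl zeros-9

zeros-4-11 : Infinite (λ n → 11 ∣ a n × 4 ∣ a n)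
zeros-4-11 = infinite-zeros-4 1024 (s≤s (s≤s z≤n)) 1023 (<ᵇ⇒< _ _ tt) 10 (s≤s z≤n) []
  ((1 , 0 ∷ 1 ∷ 2 ∷ 7 ∷ 8 ∷ []) ∷
   [])
  refl zeros-11

zeros-4-13 : Infinite (λ n → 13 ∣ a n × 4 ∣ a n)
zeros-4-13 = infinite-zeros-4 1024 (s≤s (s≤s z≤n)) 1023 (<ᵇ⇒< _ _ tt) 12 (s≤s z≤n) []
  ((1 , 0 ∷ 1 ∷ 2 ∷ 3 ∷ 9 ∷ 10 ∷ []) ∷
   [])
  refl zeros-13

zeros-4-15 : Infinite (λ n → 15 ∣ a n × 4 ∣ a n)
zeros-4-15 = infinite-zeros-4 1024 (s≤s (s≤s z≤n)) 1023 (<ᵇ⇒< _ _ tt) 14 (s≤s z≤n) (2 ∷ 6 ∷ 2 ∷ 10 ∷ [])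
  ((1 , 0 ∷ 1 ∷ 2 ∷ 3 ∷ 4 ∷ 11 ∷ 12 ∷ []) ∷
   (3 , 1 ∷ 2 ∷ 3 ∷ 4 ∷ 6 ∷ []) ∷
   (5 , 0 ∷ 1 ∷ 3 ∷ []) ∷
   [])
  refl zeros-15

zeros-4-17 : Infinite (λ n → 17 ∣ a n × 4 ∣ a n)
zeros-4-17 = infinite-zeros-4 1024 (s≤s (s≤s z≤n)) 1023 (<ᵇ⇒< _ _ tt) 16 (s≤s z≤n) []
  ((1 , 0 ∷ 1 ∷ 2 ∷ 3 ∷ 4 ∷ 5 ∷ 13 ∷ 14 ∷ []) ∷
   [])
  refl zeros-17

zeros-4-19 : Infinite (λ n → 19 ∣ a n × 4 ∣ a n)
zeros-4-19 = infinite-zeros-4 1024 (s≤s (s≤s z≤n)) 1023 (<ᵇ⇒< _ _ tt) 18 (s≤s z≤n) []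
  ((1 , 0 ∷ 1 ∷ 2 ∷ 3 ∷ 4 ∷ 5 ∷ 6 ∷ 15 ∷ 16 ∷ []) ∷
   [])
  refl zeros-19

-- Even h and the conclusion.

*-∣ : ∀ {m n x} → Coprime n m → m ∣ x → n ∣ x → m * n ∣ x
*-∣ {m} {n} co (divides q refl) n∣x =
  subst (m * n ∣_) (*-comm m q) (*-monoʳ-∣ m (coprime-divisor co (subst (n ∣_) (*-comm q m) n∣x)))

conclude : ∀ {h} → Infinite (λ n → h ∣ a n) → InfinitelyMany (λ n → h ∣ b₂ n)
conclude zeros N with zeros N
... | n , N≤n , _ , h∣a = double n , ≤-trans N≤n (≤-trans (m≤m+n n _) (≤-reflexive (sym (double≡2* n)))) , subst (_ ∣_) (a-b₂ n) h∣a

twice : ∀ {k} → gcd k 2 ≡ 1 → Infinite (λ n → k ∣ a n) → Infinite (λ n → 2 * k ∣ a n)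
twice co zeros N with zeros N
... | suc n , N≤n , 2≤n , k∣a = suc n , N≤n , 2≤n , *-∣ (gcd≡1⇒coprime co) (a-even n) k∣a

fourTimes : ∀ {k} → gcd k 4 ≡ 1 → Infinite (λ n → k ∣ a n × 4 ∣ a n) → Infinite (λ n → 4 * k ∣ a n)
fourTimes co zeros N with zeros N
... | n , N≤n , 2≤n , k∣a , 4∣a = n , N≤n , 2≤n , *-∣ (gcd≡1⇒coprime co) 4∣a k∣a

zeros-4 : Infinite (λ n → 4 ∣ a n)
zeros-4 N with zeros-4-3 N
... | n , N≤n , 2≤n , _ , 4∣a = n , N≤n , 2≤n , 4∣a

Claim : ℕ → Set
Claim h = 3 ≤ h → ¬ (8 ∣ h) → Infinite (λ n → h ∣ a n)

-- As 8 does not divide h, h is k, 2k or 4k with k odd. The factor 2 comes from `a-even`, the factor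
-- 4 from the restricted searches; h = 4 follows from the one for 12.
small : All Claim (upTo 42)
small =
  (λ ()) ∷ (λ { (s≤s ()) }) ∷ (λ { (s≤s (s≤s ())) }) ∷ good zeros-3 ∷ good zeros-4 ∷ good zeros-5 ∷
  good (twice refl zeros-3) ∷ good zeros-7 ∷ eight 1 ∷ good zeros-9 ∷ good (twice refl zeros-5) ∷
  good zeros-11 ∷ good (fourTimes refl zeros-4-3) ∷ good zeros-13 ∷ good (twice refl zeros-7) ∷
  good zeros-15 ∷ eight 2 ∷ good zeros-17 ∷ good (twice refl zeros-9) ∷ good zeros-19 ∷
  good (fourTimes refl zeros-4-5) ∷ good zeros-21 ∷ good (twice refl zeros-11) ∷ good zeros-23 ∷
  eight 3 ∷ good zeros-25 ∷ good (twice refl zeros-13) ∷ good zeros-27 ∷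
  good (fourTimes refl zeros-4-7) ∷ good zeros-29 ∷ good (twice refl zeros-15) ∷ good zeros-31 ∷
  eight 4 ∷ good zeros-33 ∷ good (twice refl zeros-17) ∷ good zeros-35 ∷
  good (fourTimes refl zeros-4-9) ∷ good zeros-37 ∷ good (twice refl zeros-19) ∷ good zeros-39 ∷
  eight 5 ∷ good zeros-41 ∷
  []
  where
  good : ∀ {h} → Infinite (λ n → h ∣ a n) → Claim h
  good zeros _ _ = zeros
  eight : ∀ q → Claim (q * 8)
  eight q _ 8∤h = ⊥-elim (8∤h (divides-refl q))

theorem7 : ∀ (h : ℕ)
    → ((3 ≤ h) × (h ≤ 41) × ¬ (8 ∣ h))
    ⊎ (h ≡ 44 ⊎ h ≡ 52 ⊎ h ≡ 60 ⊎ h ≡ 68 ⊎ h ≡ 76)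
    → InfinitelyMany (λ n → h ∣ b₂ n)
theorem7 h (inj₁ (3≤h , h≤41 , 8∤h)) = conclude (lookup small (∈-upTo⁺ (s≤s h≤41)) 3≤h 8∤h)
theorem7 _ (inj₂ (inj₁ refl))                      = conclude (fourTimes refl zeros-4-11)
theorem7 _ (inj₂ (inj₂ (inj₁ refl)))               = conclude (fourTimes refl zeros-4-13)
theorem7 _ (inj₂ (inj₂ (inj₂ (inj₁ refl))))        = conclude (fourTimes refl zeros-4-15)
theorem7 _ (inj₂ (inj₂ (inj₂ (inj₂ (inj₁ refl))))) = conclude (fourTimes refl zeros-4-17)
theorem7 _ (inj₂ (inj₂ (inj₂ (inj₂ (inj₂ refl))))) = conclude (fourTimes refl zeros-4-19)
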